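{- Let $q$ be even, $t\ge 3$ a prime, $q\ge t$. In $\mathrm{PG}(2,q^t)$, let $\mathcal C$ be a conic and let $\mathcal D$ be an André set of $\ell_\infty$. For $m\in\{1,\ldots,t-1\}$ perform an André replacement using the André replacement net $\mathcal D^m$, and let $\mathcal D_m(\mathcal C)$ denote the set of points in the André plane $\mathcal P(\mathcal D^m)$ corresponding to the affine points of $\mathcal C$. If $\mathcal C$ is either exterior or secant to $\ell_\infty$, then $\mathcal D_m(\mathcal C)$ is not an arc in $\mathcal P(\mathcal D^m)$ for any $m\in\{1,\ldots,t-1\}$.
   Context: Conics are non-degenerate. Homogeneous coordinates of $\mathrm{PG}(2,q^t)$ are $(x,y,z)$, with $\ell_\infty$ the line $z=0$; the point $(x,y,0)$ of $\ell_\infty\cong\mathrm{PG}(1,q^t)$ is also written $(x,y)$. Affine points are the points not on $\ell_\infty$; $(x,y,1)$ is identified with the vector $(x,y)\in V=\mathbb F_{q^t}^2$. A line is exterior, tangent, secant to a conic if it meets it in $0,1,2$ points respectively. An arc of a projective plane is a set of points, no three collinear. Norm: $\mathrm N(k)=k^{1+q+\cdots+q^{t-1}}$ for $k\in\mathbb F_{q^t}$. André sets: for distinct points $E,F$ of $\mathrm{PG}(1,q^t)$, let $G\le \mathrm{PGL}(2,q^t)$ be the group (cyclic of order $q^t-1$) of projectivities fixing both $E$ and $F$, and $H$ its unique subgroup of order $q^{t-1}+\cdots+q+1$. The $q-1$ orbits of $H$ on $\mathrm{PG}(1,q^t)\setminus\{E,F\}$ are the André sets with transversal points $E,F$. The André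 sets with transversal points $(1,0),(0,1)$ are $\mathcal A_\delta=\{(1,\theta)\mid \theta\in\mathbb F_{q^t}^*,\ \mathrm N(\theta)=\delta\}$, $\delta\in\mathbb F_q^*$, and every André set is the image of such a set under a projectivity. Bruck–Bose representation: regard $V$ as a $2t$-dimensional $\mathbb F_q$-space, so affine points of $\mathrm{PG}(2,q^t)$ are the points of $\mathrm{AG}(2t,q)$. A point $P=(x,y)$ of $\ell_\infty$ corresponds to the $t$-dimensional $\mathbb F_q$-subspace $[P]=\{(sx,sy)\mid s\in\mathbb F_{q^t}\}$ of $V$ (projectively a $(t-1)$-space of the hyperplane at infinity $\mathrm{PG}(2t-1,q)$); the affine lines through $P$ are the cosets of $[P]$. André replacement nets: for $\mathcal D=\mathcal A_\delta$ and $m\in\{1,\ldots,t-1\}$, $\mathcal D^m=\{X_{m,u}\mid u\in\mathbb F_{q^t}^*,\mathrm N(u)=\delta\}$ where $X_{m,u}=\{(s,s^{q^m}u)\mid s\in\mathbb F_{q^t}\}$, a $t$-dimensional $\mathbb F_q$-subspace of $V$. For a general André set $\mathcal D$, choose $\varphi\in\mathrm{GL}(2,q^t)$ inducing a projectivity mapping some $\mathcal A_\delta$ to $\mathcal D$; the $t-1$ replacement nets of $\mathcal D$ are $\mathcal D^m=\{\varphi(X_{m,u})\}$, the images of those of $\mathcal A_\delta$. André replacement: a $\mathcal D^m$-block is a coset in $V$ of a member of $\mathcal D^m$. The incidence structure whose points are the affine points of $\mathrm{PG}(2,q^t)$ and whose lines are the affine lines of $\mathrm{PG}(2,q^t)$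 meeting $\ell_\infty$ in a point not in $\mathcal D$, together with the $\mathcal D^m$-blocks, is an affine plane of order $q^t$; its projective completion is the André plane $\mathcal P(\mathcal D^m)$. -}

module Defs where

open import Algebra.Bundles using (CommutativeRing; Semiring)
open import Algebra.Structures using (IsCommutativeRing)
open import Data.Empty using (⊥)
open import Data.Fin.Base using (Fin)
open import Data.List.Base using (map; sum; upTo)
open import Data.Nat.Base as ℕ using (ℕ)
open import Data.Nat.Primality using (Prime)
open import Data.Product using (Σ; ∃; ∃₂; _×_; _,_; proj₁)
open import Data.Sum.Base using (_⊎_; inj₁; inj₂)
open import Data.Sum.Relation.Binary.Pointwise using (Pointwise)
open import Data.Unit.Base using (⊤)
open import Data.Vec.Base as Vec using (Vec; []; _∷_; zipWith; replicate)
open import Function.Base using (_on_)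
open import Function.Bundles using (_⇔_; _↔_)
open import Function.Definitions using (Bijective)
open import Level using (0ℓ) renaming (suc to lsuc)
open import Relation.Binary.Core using (Rel; REL)
open import Relation.Binary.PropositionalEquality using (_≡_; _≢_)
open import Relation.Nullary.Negation using (¬_)
open import Relation.Unary using (Pred; _∈_; _∉_)
import Algebra.Definitions.RawSemiring as RawSemiringDefinitions

IsPrimePower : ℕ → Set
IsPrimePower q = ∃₂ λ p h → Prime p × 1 ℕ.≤ h × q ≡ p ℕ.^ h

record FiniteField (n : ℕ) : Set₁ where
  infixl 6 _+_
  infixl 7 _*_
  infix  8 -_
  field
    Carrier           : Set
    _+_ _*_           : Carrier → Carrier → Carrier
    -_                : Carrier → Carrier
    0# 1#             : Carrier
    isCommutativeRing : IsCommutativeRing _≡_ _+_ _*_ -_ 0# 1#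
    1#≢0#             : 1# ≢ 0#
    inverse           : ∀ x → x ≢ 0# → ∃ λ y → x * y ≡ 1#
    enumeration       : Carrier ↔ Fin n

  commutativeRing : CommutativeRing 0ℓ 0ℓ
  commutativeRing = record { isCommutativeRing = isCommutativeRing }

  open CommutativeRing commutativeRing public using (_-_)
  open RawSemiringDefinitions
    (Semiring.rawSemiring (CommutativeRing.semiring commutativeRing)) public using (_^_)

------------------------------------------------------------------------
-- Incidence structures

record IncidenceStructure : Set₁ where
  infix 4 _≈_ _I_ _∥_
  field
    Point : Set
    _≈_   : Rel Point 0ℓ
    Line  : Set
    _I_   : REL Point Line 0ℓ

  -- Lines are compared by their point sets, since `Line` may contain several
  -- representatives of the same line.
  _∥_ : Rel Line 0ℓ
  l ∥ l′ = (∀ p → (p I l) ⇔ (p I l′)) ⊎ (∀ p → ¬ (p I l × p I l′))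

  IsArc : Pred Point 0ℓ → Set
  IsArc A = ∀ x y z → x ∈ A → y ∈ A → z ∈ A →
            ¬ x ≈ y → ¬ x ≈ z → ¬ y ≈ z →
            ∀ l → ¬ (x I l × y I l × z I l)

-- The projective completion of an affine plane: `inj₂ l` is the parallel class
-- of l, and `inj₂ _` as a line is the line at infinity.
completion : IncidenceStructure → IncidenceStructure
completion 𝒜 = record
  { Point = Point ⊎ Line
  ; _≈_   = Pointwise _≈_ _∥_
  ; Line  = Line ⊎ ⊤
  ; _I_   = λ where
      (inj₁ p) (inj₁ l) → p I l
      (inj₁ p) (inj₂ _) → ⊥
      (inj₂ k) (inj₁ l) → k ∥ l
      (inj₂ k) (inj₂ _) → ⊤
  }
  where open IncidenceStructure 𝒜

------------------------------------------------------------------------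
-- PG(2,qᵗ), with K = 𝔽_{qᵗ}

module Geometry (q t : ℕ) (K : FiniteField (q ℕ.^ t)) where

  open FiniteField K

  infixl 6 _+ᵛ_
  infixr 7 _*ᵛ_
  infix  4 _∼_ _≋_
  infixr 8 _·_
  infixl 7 _∙_

  _+ᵛ_ : ∀ {n} → Vec Carrier n → Vec Carrier n → Vec Carrier n
  _+ᵛ_ = zipWith _+_

  _*ᵛ_ : ∀ {n} → Carrier → Vec Carrier n → Vec Carrier n
  c *ᵛ v = Vec.map (c *_) v

  0ᵛ : ∀ {n} → Vec Carrier n
  0ᵛ = replicate _ 0#

  _∼_ : ∀ {n} → Rel (Vec Carrier n) 0ℓ
  v ∼ w = ∃ λ c → c ≢ 0# × w ≡ c *ᵛ v

  -- PG d is PG(d,qᵗ); two elements are the same point when their coordinate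
  -- vectors are related by _∼_.
  PG : ℕ → Set
  PG d = Σ (Vec Carrier (ℕ.suc d)) (_≢ 0ᵛ)

  V : Set
  V = Vec Carrier 2

  ----------------------------------------------------------------------
  -- Conics

  -- The form a x² + b y² + c z² + f y z + g x z + h x y.
  record QuadraticForm : Set where
    field
      a b c f g h : Carrier

    eval : Vec Carrier 3 → Carrier
    eval (x ∷ y ∷ z ∷ []) =
      a * x * x + b * y * y + c * z * z + f * y * z + g * x * z + h * x * y

    polar : Vec Carrier 3 → Vec Carrier 3 → Carrier
    polar v w = eval (v +ᵛ w) - eval v - eval w

    -- In characteristic 2 and dimension 3 the polar form is always degenerate,
    -- so only vectors of its radical on which the form itself vanishes are
    -- excluded.
    NonDegenerate : Set
    NonDegenerate = ∀ v → eval v ≡ 0# → (∀ w → polar v w ≡ 0#) → v ≡ 0ᵛ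

  record Conic : Set where
    field
      form          : QuadraticForm
      nonDegenerate : QuadraticForm.NonDegenerate form

    points : Pred (PG 2) 0ℓ
    points (v , _) = QuadraticForm.eval form v ≡ 0#

    affinePoints : Pred V 0ℓ
    affinePoints (x ∷ y ∷ []) = QuadraticForm.eval form (x ∷ y ∷ 1# ∷ []) ≡ 0#

  ℓ∞ : Pred (PG 2) 0ℓ
  ℓ∞ ((x ∷ y ∷ z ∷ []) , _) = z ≡ 0#

  Exterior : Pred (PG 2) 0ℓ → Conic → Set
  Exterior ℓ 𝒞 = ∀ P → P ∈ ℓ → P ∉ Conic.points 𝒞

  Secant : Pred (PG 2) 0ℓ → Conic → Set
  Secant ℓ 𝒞 = ∃₂ λ P R →
    Meet P × Meet R × ¬ (proj₁ P ∼ proj₁ R) ×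
    (∀ S → Meet S → (proj₁ S ∼ proj₁ P) ⊎ (proj₁ S ∼ proj₁ R))
    where
    Meet : Pred (PG 2) 0ℓ
    Meet P = P ∈ ℓ × P ∈ Conic.points 𝒞

  ----------------------------------------------------------------------
  -- Projectivities of ℓ∞ ≅ PG(1,qᵗ)

  record Matrix : Set where
    constructor mat
    field
      m₁₁ m₁₂ m₂₁ m₂₂ : Carrier

    det : Carrier
    det = m₁₁ * m₂₂ - m₁₂ * m₂₁

  open Matrix public using (det)

  _·_ : Matrix → V → V
  mat a b c d · (x ∷ y ∷ []) = (a * x + b * y) ∷ (c * x + d * y) ∷ []

  _∙_ : Matrix → Matrix → Matrix
  mat a b c d ∙ mat a′ b′ c′ d′ =
    mat (a * a′ + b * c′) (a * b′ + b * d′)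
        (c * a′ + d * c′) (c * b′ + d * d′)

  identity : Matrix
  identity = mat 1# 0# 0# 1#

  -- For an invertible matrix this is a scalar multiple of the inverse, hence
  -- represents the inverse projectivity.
  adjugate : Matrix → Matrix
  adjugate (mat a b c d) = mat d (- b) (- c) a

  -- Equality in PGL(2,qᵗ).
  _≋_ : Rel Matrix 0ℓ
  mat a b c d ≋ g = ∃ λ k → k ≢ 0# × g ≡ mat (k * a) (k * b) (k * c) (k * d)

  -- H, a set of matrices closed under nonzero scaling, represents a subgroup
  -- of PGL(2,qᵗ).
  record IsSubgroup (H : Pred Matrix 0ℓ) : Set where
    field
      invertible : ∀ {g} → g ∈ H → det g ≢ 0#
      respects   : ∀ {g h} → g ≋ h → g ∈ H → h ∈ H
      ε-closed   : identity ∈ H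
      ∙-closed   : ∀ {g h} → g ∈ H → h ∈ H → g ∙ h ∈ H
      ⁻¹-closed  : ∀ {g} → g ∈ H → adjugate g ∈ H

  HasOrder : Pred Matrix 0ℓ → ℕ → Set
  HasOrder H n = ∃ λ (e : Fin n → ∃ H) → Bijective _≡_ (_≋_ on proj₁) e

  ----------------------------------------------------------------------
  -- André sets

  -- 1 + q + ⋯ + qᵗ⁻¹
  normExponent : ℕ
  normExponent = sum (map (q ℕ.^_) (upTo t))

  N : Carrier → Carrier
  N k = k ^ normExponent

  -- The group fixing E and F is cyclic, so H is determined by its order.
  IsAndréSet : Pred (PG 1) 0ℓ → Set₁
  IsAndréSet 𝒟 =
    ∃₂ λ (E F : PG 1) → ¬ (proj₁ E ∼ proj₁ F) ×
    Σ (Pred Matrix 0ℓ) λ H →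
      IsSubgroup H × HasOrder H normExponent ×
      (∀ {g} → g ∈ H → (g · proj₁ E ∼ proj₁ E) × (g · proj₁ F ∼ proj₁ F)) ×
    ∃ λ (P : PG 1) → ¬ (proj₁ P ∼ proj₁ E) × ¬ (proj₁ P ∼ proj₁ F) ×
      (∀ R → (R ∈ 𝒟) ⇔ (∃ λ g → g ∈ H × g · proj₁ P ∼ proj₁ R))

  𝒜 : Carrier → Pred (PG 1) 0ℓ
  𝒜 δ (v , _) = ∃ λ θ → θ ≢ 0# × N θ ≡ δ × v ∼ (1# ∷ θ ∷ [])

  -- A choice of φ and δ such that the projectivity induced by φ maps 𝒜 δ
  -- onto 𝒟.
  record Presentation (𝒟 : Pred (PG 1) 0ℓ) : Set where
    field
      φ            : Matrix
      φ-invertible : det φ ≢ 0#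
      δ            : Carrier
      δ≢0          : δ ≢ 0#
      δ∈𝔽q         : δ ^ q ≡ δ
      image        : ∀ R → (R ∈ 𝒟) ⇔ (∃ λ P → P ∈ 𝒜 δ × φ · proj₁ P ∼ proj₁ R)

  ----------------------------------------------------------------------
  -- André replacement

  [_] : PG 1 → Pred V 0ℓ
  [ (p , _) ] w = ∃ λ s → w ≡ s *ᵛ p

  X : ℕ → Carrier → Pred V 0ℓ
  X m u w = ∃ λ s → w ≡ s ∷ s ^ (q ℕ.^ m) * u ∷ []

  Image : Matrix → Pred V 0ℓ → Pred V 0ℓ
  Image φ U w = ∃ λ x → x ∈ U × w ≡ φ · x

  Coset : V → Pred V 0ℓ → Pred V 0ℓ
  Coset v U w = ∃ λ x → x ∈ U × w ≡ v +ᵛ x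

  module _ (𝒟 : Pred (PG 1) 0ℓ) (ρ : Presentation 𝒟) (m : ℕ) where

    open Presentation ρ

    data AndréLine : Set where
      line  : (P : PG 1) → P ∉ 𝒟 → (v : V) → AndréLine
      block : (u : Carrier) → u ≢ 0# → N u ≡ δ → (v : V) → AndréLine

    points : AndréLine → Pred V 0ℓ
    points (line P _ v)    = Coset v [ P ]
    points (block u _ _ v) = Coset v (Image φ (X m u))

    affineAndréPlane : IncidenceStructure
    affineAndréPlane = record
      { Point = V
      ; _≈_   = _≡_
      ; Line  = AndréLine
      ; _I_   = λ w l → w ∈ points l
      }

    AndréPlane : IncidenceStructure
    AndréPlane = completion affineAndréPlane

    AndréImage : Conic → Pred (IncidenceStructure.Point AndréPlane) 0ℓ
    AndréImage 𝒞 (inj₁ v) = v ∈ Conic.affinePoints 𝒞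
    AndréImage 𝒞 (inj₂ _) = ⊥

-- In characteristic 2 a conic that is not tangent to ℓ∞ has an affine nucleus n
-- and consists of the points n + w with Q(w) = D, where Q is a binary quadratic
-- form with nonzero cross term and D ≠ 0.  Pull Q back along φ and fix θ with
-- N(θ) = δ.  If p₁, p₂ ∈ X_{m,θ} are linearly independent over 𝔽_{qᵗ}, there is a
-- unique v with Q(v) = Q(v + p₁) = Q(v + p₂), and Q(v) ≠ 0 as soon as Q does not
-- vanish at p₁, p₂ and p₁ + p₂.  Every element of the field is a square, so scaling
-- by some ω achieves Q(ωv) = D, and ω maps X_{m,θ} to another member of the same
-- replacement net: the three points lie on a block.  Suitable p₁ and p₂ exist
-- because Q has at most two zeros among pairwise independent vectors of X_{m,θ}.

module Submission where

open import Defs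
open import Algebra.Bundles using (CommutativeRing)
import Algebra.Properties.CommutativeMonoid.Sum as Sum
import Algebra.Properties.CommutativeSemiring.Exp as Exp
import Algebra.Properties.Ring as RingProperties
import Algebra.Solver.Ring as RingSolver
open import Algebra.Solver.Ring.AlmostCommutativeRing using (_-Raw-AlmostCommutative⟶_; fromCommutativeRing)
import Algebra.Solver.Ring.NaturalCoefficients.Default as NaturalCoefficients
open import Data.Bool.Base using (Bool; true; false)
import Data.Bool.Properties as Bool
open import Data.Empty using (⊥)
open import Data.Fin.Base as Fin using (Fin; punchIn)
open import Data.Fin.Patterns using (0F; 1F; 2F)
open import Data.Fin.Permutation using (Permutation; _⟨$⟩ʳ_)
import Data.Fin.Properties as Fin
open import Data.List.Base as List using (map; upTo; _∷ʳ_)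
open import Data.List.Properties using (upTo-∷ʳ; map-++)
import Data.Maybe.Base as Maybe
open import Data.Nat.Base as ℕ using (ℕ; zero; suc)
open import Data.Nat.Divisibility as ℕ using (_∣_; divides)
open import Data.Nat.ListAction using (sum)
open import Data.Nat.ListAction.Properties using (sum-++)
open import Data.Nat.Primality using (Prime; prime[2]; euclidsLemma; prime⇒irreducible)
import Data.Nat.Properties as ℕ
open import Data.Nat.Tactic.RingSolver using (solve-∀)
open import Data.Product using (∃; ∃₂; _×_; _,_; proj₁; proj₂)
open import Data.Sum.Base using (_⊎_; inj₁; inj₂)
import Data.Sum.Relation.Binary.Pointwise as Pointwise
open import Data.Vec.Base as Vec using (Vec; []; _∷_)
open import Data.Vec.Functional using (removeAt; replicate)
import Data.Vec.Properties as Vec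
open import Function.Base using (_∘_)
open import Function.Bundles using (Equivalence; Injection; Inverse; _↔_; mk↔ₛ′)
open import Function.Construct.Composition using (_↔-∘_)
open import Function.Construct.Symmetry using (↔-sym)
open import Function.Definitions using (Injective)
open import Function.Properties.Inverse using (Inverse⇒Injection)
open import Level using (0ℓ)
open import Relation.Binary.Definitions using (DecidableEquality)
open import Relation.Binary.PropositionalEquality
open import Relation.Nullary using (Dec; yes; no; ¬_; contradiction)
open import Relation.Nullary.Decidable using (decidable-stable; dec⇒maybe)
open import Relation.Unary using (Pred; _∈_)

-- Finite fields: the identity xⁿ = x, roots of polynomials, and consequences of even order.

module FiniteFieldProperties {n : ℕ} (K : FiniteField n) where

  open FiniteField K
  open CommutativeRing commutativeRing public
    using ( +-identityˡ; +-identityʳ; -‿inverseʳ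
          ; *-comm; *-assoc; *-identityˡ; *-identityʳ; zeroˡ; zeroʳ
          ; distribˡ; ring; commutativeSemiring; *-commutativeMonoid)
  open Exp commutativeSemiring public using (^-homo-*; ^-assocʳ; ^-distrib-*)
  open RingProperties ring public using (-‿distribˡ-*; -‿distribʳ-*; -‿involutive; x∙y⁻¹≈ε⇒x≈y)
  open NaturalCoefficients commutativeSemiring using (solve; con; _:=_; _:+_; _:*_)
  open ≡-Reasoning

  open Inverse enumeration using () renaming (to to index; from to element)

  element-index : ∀ x → element (index x) ≡ x
  element-index = Inverse.strictlyInverseʳ enumeration

  infix 4 _≟_
  _≟_ : DecidableEquality Carrier
  _≟_ = Fin.inj⇒≟ (Inverse⇒Injection enumeration)

  *-cancelˡ-≢0 : ∀ {x y z} → x ≢ 0# → x * y ≡ x * z → y ≡ z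
  *-cancelˡ-≢0 {x} {y} {z} x≢0 xy≡xz = begin
    y             ≡⟨ strip y ⟨
    x⁻¹ * (x * y) ≡⟨ cong (x⁻¹ *_) xy≡xz ⟩
    x⁻¹ * (x * z) ≡⟨ strip z ⟩
    z             ∎
    where
    x⁻¹ = inverse x x≢0 .proj₁
    strip : ∀ w → x⁻¹ * (x * w) ≡ w
    strip w = begin
      x⁻¹ * (x * w) ≡⟨ *-assoc x⁻¹ x w ⟨
      x⁻¹ * x * w   ≡⟨ cong (_* w) (trans (*-comm x⁻¹ x) (inverse x x≢0 .proj₂)) ⟩
      1# * w        ≡⟨ *-identityˡ w ⟩
      w             ∎

  x*y≡0⇒y≡0 : ∀ {x y} → x ≢ 0# → x * y ≡ 0# → y ≡ 0#
  x*y≡0⇒y≡0 {x} x≢0 xy≡0 = *-cancelˡ-≢0 x≢0 (trans xy≡0 (sym (zeroʳ x)))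

  x*y≢0 : ∀ {x y} → x ≢ 0# → y ≢ 0# → x * y ≢ 0#
  x*y≢0 x≢0 y≢0 xy≡0 = y≢0 (x*y≡0⇒y≡0 x≢0 xy≡0)

  x*y≡1⇒y≢0 : ∀ {x y} → x * y ≡ 1# → y ≢ 0#
  x*y≡1⇒y≢0 {x} xy≡1 refl = 1#≢0# (trans (sym xy≡1) (zeroʳ x))

  x*x≡0⇒x≡0 : ∀ {x} → x * x ≡ 0# → x ≡ 0#
  x*x≡0⇒x≡0 {x} xx≡0 = decidable-stable (x ≟ 0#) λ x≢0 → x*y≢0 x≢0 x≢0 xx≡0

  x^k≢0 : ∀ {x} k → x ≢ 0# → x ^ k ≢ 0#
  x^k≢0 zero    x≢0 = 1#≢0#
  x^k≢0 (suc k) x≢0 = x*y≢0 x≢0 (x^k≢0 k x≢0)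

  1^k≡1 : ∀ k → 1# ^ k ≡ 1#
  1^k≡1 zero    = refl
  1^k≡1 (suc k) = trans (*-identityˡ _) (1^k≡1 k)

  ^-swap : ∀ x k l → (x ^ k) ^ l ≡ (x ^ l) ^ k
  ^-swap x k l = begin
    (x ^ k) ^ l   ≡⟨ ^-assocʳ x k l ⟩
    x ^ (k ℕ.* l) ≡⟨ cong (x ^_) (ℕ.*-comm k l) ⟩
    x ^ (l ℕ.* k) ≡⟨ ^-assocʳ x l k ⟨
    (x ^ l) ^ k   ∎

  ^-fixed : ∀ {x k} m → x ^ k ≡ x → x ^ (k ℕ.^ m) ≡ x
  ^-fixed {x} {k} zero    _     = *-identityʳ x
  ^-fixed {x} {k} (suc m) xᵏ≡x = begin
    x ^ (k ℕ.* k ℕ.^ m) ≡⟨ ^-assocʳ x k (k ℕ.^ m) ⟨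
    (x ^ k) ^ (k ℕ.^ m) ≡⟨ cong (_^ (k ℕ.^ m)) xᵏ≡x ⟩
    x ^ (k ℕ.^ m)       ≡⟨ ^-fixed m xᵏ≡x ⟩
    x                    ∎

  -- Multiplication by w permutes the field, so the product P of the nonzero
  -- elements satisfies P · w = wⁿ · P; the extra factor w stands for the zero
  -- element, which P omits.
  module _ {w : Carrier} (w≢0 : w ≢ 0#) where

    private
      module P = Sum *-commutativeMonoid

      w⁻¹ : Carrier
      w⁻¹ = inverse w w≢0 .proj₁

      w*w⁻¹*x : ∀ x → w * (w⁻¹ * x) ≡ x
      w*w⁻¹*x x = trans (sym (*-assoc _ _ _))
        (trans (cong (_* x) (inverse w w≢0 .proj₂)) (*-identityˡ x))

      scaling : Carrier ↔ Carrier
      scaling = mk↔ₛ′ (w *_) (w⁻¹ *_) w*w⁻¹*x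
        (λ x → *-cancelˡ-≢0 w≢0 (w*w⁻¹*x (w * x)))

      π : Permutation n n
      π = (enumeration ↔-∘ scaling) ↔-∘ ↔-sym enumeration

      0↦1 0↦w : Carrier → Carrier
      0↦1 x with x ≟ 0#
      ... | yes _ = 1#
      ... | no  _ = x
      0↦w x with x ≟ 0#
      ... | yes _ = w
      ... | no  _ = 1#

      0↦1≢0 : ∀ x → 0↦1 x ≢ 0#
      0↦1≢0 x with x ≟ 0#
      ... | yes _   = 1#≢0#
      ... | no  x≢0 = x≢0

      0↦w[0]≡w : 0↦w 0# ≡ w
      0↦w[0]≡w with 0# ≟ 0#
      ... | yes _   = refl
      ... | no  0≢0 = contradiction refl 0≢0

      0↦w[≢0]≡1 : ∀ {x} → x ≢ 0# → 0↦w x ≡ 1#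
      0↦w[≢0]≡1 {x} x≢0 with x ≟ 0#
      ... | yes x≡0 = contradiction x≡0 x≢0
      ... | no  _   = refl

      -- At zero the two sides are 1 · w and w · 1; at a nonzero x both are w x. Multiplying over
      -- the whole field turns this into the identity for P.
      scale-0↦1 : ∀ x → 0↦1 (w * x) * 0↦w x ≡ w * 0↦1 x
      scale-0↦1 x with x ≟ 0# | w * x ≟ 0#
      ... | yes _   | yes _    = *-comm _ _
      ... | yes x≡0 | no  wx≢0 = contradiction (trans (cong (w *_) x≡0) (zeroʳ w)) wx≢0
      ... | no  x≢0 | yes wx≡0 = contradiction wx≡0 (x*y≢0 w≢0 x≢0)
      ... | no  _   | no  _    = *-identityʳ _

      ∏ : ∀ {k} → (Fin k → Carrier) → Carrier
      ∏ = P.sum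

      ∏≢0 : ∀ {k} (f : Fin k → Carrier) → (∀ i → f i ≢ 0#) → ∏ f ≢ 0#
      ∏≢0 {zero}  f f≢0 = 1#≢0#
      ∏≢0 {suc k} f f≢0 = x*y≢0 (f≢0 Fin.zero) (∏≢0 (f ∘ Fin.suc) (f≢0 ∘ Fin.suc))

      ∏-single : ∀ {k} (f : Fin k → Carrier) i → (∀ j → j ≢ i → f j ≡ 1#) → ∏ f ≡ f i
      ∏-single {suc k} f i f≡1 = begin
        ∏ f                  ≡⟨ P.sum-remove {i = i} f ⟩
        f i * ∏ (removeAt f i) ≡⟨ cong (f i *_) (P.sum-cong-≗ λ j → f≡1 (punchIn i j) (Fin.punchInᵢ≢i i j)) ⟩
        f i * ∏ (replicate k 1#) ≡⟨ cong (f i *_) (P.sum-replicate-zero k) ⟩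
        f i * 1#             ≡⟨ *-identityʳ (f i) ⟩
        f i                  ∎

      ∏0↦w≡w : ∏ (0↦w ∘ element) ≡ w
      ∏0↦w≡w = begin
        ∏ (0↦w ∘ element)          ≡⟨ ∏-single _ (index 0#) (λ j j≢ → 0↦w[≢0]≡1 λ eq →
                                        j≢ (trans (sym (Inverse.strictlyInverseˡ enumeration j)) (cong index eq))) ⟩
        0↦w (element (index 0#))   ≡⟨ cong 0↦w (element-index 0#) ⟩
        0↦w 0#                     ≡⟨ 0↦w[0]≡w ⟩
        w                          ∎

    x≢0⇒x^n≡x : w ^ n ≡ w
    x≢0⇒x^n≡x = sym (*-cancelˡ-≢0 (∏≢0 (0↦1 ∘ element) (0↦1≢0 ∘ element)) (begin
      ∏ f * w                                 ≡⟨ cong₂ _*_ (P.sum-permute f π) (sym ∏0↦w≡w) ⟩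
      ∏ (f ∘ (π ⟨$⟩ʳ_)) * ∏ (0↦w ∘ element)   ≡⟨ P.∑-distrib-+ {n} _ _ ⟨
      ∏ (λ i → f (π ⟨$⟩ʳ i) * 0↦w (element i)) ≡⟨ P.sum-cong-≗ (λ i → trans
                                                    (cong (λ x → 0↦1 x * 0↦w (element i)) (element-index (w * element i)))
                                                    (scale-0↦1 (element i))) ⟩
      ∏ (λ i → w * f i)                       ≡⟨ P.∑-distrib-+ {n} (λ _ → w) f ⟩
      ∏ {n} (λ _ → w) * ∏ f                   ≡⟨ cong (_* ∏ f) (P.sum-replicate n) ⟩
      w ^ n * ∏ f                             ≡⟨ *-comm _ _ ⟩
      ∏ f * w ^ n                             ∎))
      where f = 0↦1 ∘ element

  fermat : ∀ x → x ^ n ≡ x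
  fermat x with x ≟ 0#
  ... | no  x≢0  = x≢0⇒x^n≡x x≢0
  -- `index 0#` inhabits `Fin n` and so excludes n = 0, for which the power would be 1.
  ... | yes refl = 0^n (index 0#)
    where
    0^n : ∀ {k} → Fin k → 0# ^ k ≡ 0#
    0^n {suc k} _ = zeroˡ _

  -- The monic polynomial of degree d with lower coefficients cs, constant term
  -- first.
  monic : ∀ {d} → Vec Carrier d → Carrier → Carrier
  monic []       x = 1#
  monic (c ∷ cs) x = x * monic cs x + c

  -- The factor theorem f(x) = f(a) + (x − a) g(x), without subtraction.
  divide : ∀ {d} (cs : Vec Carrier (suc d)) a →
           ∃ λ ds → ∀ x → monic cs x + a * monic {d} ds x ≡ monic cs a + x * monic ds x
  divide (c ∷ [])        a = [] , λ x →
    solve 3 (λ x a c → x :* con 1 :+ c :+ a :* con 1 := a :* con 1 :+ c :+ x :* con 1) refl x a c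
  divide (c ∷ cs@(_ ∷ _)) a = let ds , f≡g = divide cs a in
    monic cs a ∷ ds , λ x → begin
      x * monic cs x + c + a * (x * monic ds x + monic cs a)
        ≡⟨ solve 6 (λ x a c f fa g → x :* f :+ c :+ a :* (x :* g :+ fa) := x :* (f :+ a :* g) :+ (c :+ a :* fa))
             refl x a c (monic cs x) (monic cs a) (monic ds x) ⟩
      x * (monic cs x + a * monic ds x) + (c + a * monic cs a)
        ≡⟨ cong (λ y → x * y + (c + a * monic cs a)) (f≡g x) ⟩
      x * (monic cs a + x * monic ds x) + (c + a * monic cs a)
        ≡⟨ solve 5 (λ x a c fa g → x :* (fa :+ x :* g) :+ (c :+ a :* fa) := a :* fa :+ c :+ x :* (x :* g :+ fa))
             refl x a c (monic cs a) (monic ds x) ⟩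
      a * monic cs a + c + x * (x * monic ds x + monic cs a)
        ∎

  -- Divide off the first root a. At any other root x the factor identity reads a g(x) = x g(x), so
  -- g(x) ≠ 0 would give x = a, against injectivity. The remaining points are thus roots of the
  -- quotient, whose degree is one lower.
  roots≤degree : ∀ {d} (cs : Vec Carrier d) (r : Fin (suc d) → Carrier) → Injective _≡_ _≡_ r →
                 ¬ (∀ i → monic cs (r i) ≡ 0#)
  roots≤degree {zero}  []  r r-inj f≡0 = 1#≢0# (f≡0 Fin.zero)
  roots≤degree {suc d} cs r r-inj f≡0 =
    let a = r Fin.zero ; ds , f≡g = divide cs a in
    roots≤degree ds (r ∘ Fin.suc) (Fin.suc-injective ∘ r-inj) λ i →
    let x = r (Fin.suc i) ; g = monic ds x in
    decidable-stable (g ≟ 0#) λ g≢0 → Fin.0≢1+n (r-inj (*-cancelˡ-≢0 g≢0 (begin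
      g * a             ≡⟨ *-comm g a ⟩
      a * g             ≡⟨ +-identityˡ _ ⟨
      0# + a * g        ≡⟨ cong (_+ a * g) (f≡0 (Fin.suc i)) ⟨
      monic cs x + a * g ≡⟨ f≡g x ⟩
      monic cs a + x * g ≡⟨ cong (_+ x * g) (f≡0 Fin.zero) ⟩
      0# + x * g        ≡⟨ +-identityˡ _ ⟩
      x * g             ≡⟨ *-comm x g ⟩
      g * x             ∎)))

  monic-0s : ∀ d x → monic (Vec.replicate d 0#) x ≡ x ^ d
  monic-0s zero    x = refl
  monic-0s (suc d) x = trans (+-identityʳ _) (cong (x *_) (monic-0s d x))

  -- Otherwise every element would be a root of x^k - x, which for k ≥ 2 is monic of degree k; since
  -- k < n, there are k + 1 distinct elements to contradict the root bound.
  ∃x^k≢x : ∀ {k} → 2 ℕ.≤ k → k ℕ.< n → ∃ λ x → x ^ k ≢ x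
  ∃x^k≢x {suc zero}    (ℕ.s≤s ()) _
  ∃x^k≢x {suc (suc k)} _ k<n = element (proj₁ non-fixed) , proj₂ non-fixed
    where
    cs = 0# ∷ - 1# ∷ Vec.replicate k 0#

    monic-cs : ∀ x → monic cs x ≡ x ^ suc (suc k) - x
    monic-cs x = begin
      x * (x * monic (Vec.replicate k 0#) x + - 1#) + 0# ≡⟨ +-identityʳ _ ⟩
      x * (x * monic (Vec.replicate k 0#) x + - 1#)      ≡⟨ cong (λ y → x * (x * y + - 1#)) (monic-0s k x) ⟩
      x * (x ^ suc k + - 1#)                            ≡⟨ distribˡ x _ _ ⟩
      x ^ suc (suc k) + x * - 1#                        ≡⟨ cong (x ^ suc (suc k) +_) (begin
        x * - 1#   ≡⟨ -‿distribʳ-* x 1# ⟨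
        - (x * 1#) ≡⟨ cong -_ (*-identityʳ x) ⟩
        - x        ∎) ⟩
      x ^ suc (suc k) - x                               ∎

    all-fixed : ¬ (∀ i → element i ^ suc (suc k) ≡ element i)
    all-fixed fixed = roots≤degree cs (λ i → element (Fin.inject≤ i k<n))
      (λ eq → Fin.inject≤-injective _ _ _ _ (Injection.injective (Inverse⇒Injection (↔-sym enumeration)) eq))
      (λ i → let x = element (Fin.inject≤ i k<n) in begin
        monic cs x           ≡⟨ monic-cs x ⟩
        x ^ suc (suc k) - x ≡⟨ cong (_- x) (fixed (Fin.inject≤ i k<n)) ⟩
        x - x               ≡⟨ -‿inverseʳ x ⟩
        0#                  ∎)

    non-fixed : ∃ λ i → element i ^ suc (suc k) ≢ element i
    non-fixed = Fin.¬∀⟶∃¬ n _ (λ i → element i ^ suc (suc k) ≟ element i) all-fixed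

  -- By `fermat` -1 equals (-1)ⁿ, which is 1 for even n.
  even⇒1+1≡0 : 2 ∣ n → 1# + 1# ≡ 0#
  even⇒1+1≡0 (divides k n≡k*2) = begin
    1# + 1#   ≡⟨ cong (1# +_) -1≡1 ⟨
    1# - 1#   ≡⟨ -‿inverseʳ 1# ⟩
    0#        ∎
    where
    -1≡1 : - 1# ≡ 1#
    -1≡1 = begin
      - 1#                 ≡⟨ fermat (- 1#) ⟨
      (- 1#) ^ n           ≡⟨ cong ((- 1#) ^_) (trans n≡k*2 (ℕ.*-comm k 2)) ⟩
      (- 1#) ^ (2 ℕ.* k)   ≡⟨ ^-assocʳ (- 1#) 2 k ⟨
      ((- 1#) ^ 2) ^ k     ≡⟨ cong (_^ k) (begin
        - 1# * (- 1# * 1#)  ≡⟨ cong ((- 1#) *_) (*-identityʳ _) ⟩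
        - 1# * - 1#         ≡⟨ -‿distribˡ-* 1# (- 1#) ⟨
        - (1# * - 1#)       ≡⟨ cong -_ (*-identityˡ _) ⟩
        - - 1#              ≡⟨ -‿involutive 1# ⟩
        1#                  ∎) ⟩
      1# ^ k               ≡⟨ 1^k≡1 k ⟩
      1#                   ∎

  -- Halve the exponent in `fermat`: the power x^(n/2) squares to xⁿ = x.
  even⇒square : 2 ∣ n → ∀ x → ∃ λ y → y * y ≡ x
  even⇒square (divides k n≡k*2) x = x ^ k , (begin
    x ^ k * x ^ k   ≡⟨ cong (x ^ k *_) (*-identityʳ _) ⟨
    (x ^ k) ^ 2     ≡⟨ ^-assocʳ x k 2 ⟩
    x ^ (k ℕ.* 2)   ≡⟨ cong (x ^_) n≡k*2 ⟨
    x ^ n           ≡⟨ fermat x ⟩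
    x               ∎)

  -- Characteristic 2

  module Characteristic2 (1+1≡0 : 1# + 1# ≡ 0#) where

    private
      ⟦_⟧ : Bool → Carrier
      ⟦ false ⟧ = 0#
      ⟦ true  ⟧ = 1#

      F₂⟶K : CommutativeRing.rawRing Bool.xor-∧-commutativeRing -Raw-AlmostCommutative⟶ fromCommutativeRing commutativeRing
      F₂⟶K = record
        { ⟦_⟧    = ⟦_⟧
        ; +-homo = λ where
            false y     → sym (+-identityˡ _)
            true  false → sym (+-identityʳ _)
            true  true  → sym 1+1≡0
        ; *-homo = λ where
            false y → sym (zeroˡ _)
            true  y → sym (*-identityˡ _)
        ; -‿homo = λ where
            false → sym (trans (sym (+-identityˡ _)) (-‿inverseʳ 0#))
            true  → x∙y⁻¹≈ε⇒x≈y 1# (- 1#) (trans (cong (1# +_) (-‿involutive 1#)) 1+1≡0)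
        ; 0-homo = refl
        ; 1-homo = refl
        }

    -- Normalises with coefficients in 𝔽₂, so that x + x cancels.
    open RingSolver _ _ F₂⟶K (λ x y → Maybe.map (cong ⟦_⟧) (dec⇒maybe (x Bool.≟ y))) public
      using (Polynomial)
      renaming (solve to solve₂; con to con₂; _:=_ to _≔_; _:+_ to _⊕_; _:*_ to _⊗_; _:-_ to _⊖_)

    x+x≡0 : ∀ x → x + x ≡ 0#
    x+x≡0 = solve₂ 1 (λ x → x ⊕ x ≔ con₂ false) refl

    x+y≡0⇒x≡y : ∀ {x y} → x + y ≡ 0# → x ≡ y
    x+y≡0⇒x≡y {x} {y} x+y≡0 = begin
      x           ≡⟨ solve₂ 2 (λ x y → x ≔ (x ⊕ y) ⊕ y) refl x y ⟩
      (x + y) + y ≡⟨ cong (_+ y) x+y≡0 ⟩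
      0# + y      ≡⟨ +-identityˡ y ⟩
      y           ∎

    -- This power is an iterate of squaring, which is additive because the two copies of the cross
    -- term cancel.
    ^2^-distrib-+ : ∀ k x y → (x + y) ^ (2 ℕ.^ k) ≡ x ^ (2 ℕ.^ k) + y ^ (2 ℕ.^ k)
    ^2^-distrib-+ zero    x y =
      solve₂ 2 (λ x y → (x ⊕ y) ⊗ con₂ true ≔ x ⊗ con₂ true ⊕ y ⊗ con₂ true) refl x y
    ^2^-distrib-+ (suc k) x y = begin
      (x + y) ^ (2 ℕ.* 2 ℕ.^ k)           ≡⟨ square (x + y) ⟩
      (x + y) ^ M * (x + y) ^ M           ≡⟨ cong (λ z → z * z) (^2^-distrib-+ k x y) ⟩
      (x ^ M + y ^ M) * (x ^ M + y ^ M)   ≡⟨ solve₂ 2 (λ x y → (x ⊕ y) ⊗ (x ⊕ y) ≔ x ⊗ x ⊕ y ⊗ y) refl (x ^ M) (y ^ M) ⟩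
      x ^ M * x ^ M + y ^ M * y ^ M       ≡⟨ cong₂ _+_ (square x) (square y) ⟨
      x ^ (2 ℕ.* M) + y ^ (2 ℕ.* M)       ∎
      where
      M = 2 ℕ.^ k
      square : ∀ z → z ^ (2 ℕ.* M) ≡ z ^ M * z ^ M
      square z = begin
        z ^ (2 ℕ.* M)       ≡⟨ cong (λ l → z ^ (M ℕ.+ l)) (ℕ.+-identityʳ M) ⟩
        z ^ (M ℕ.+ M)       ≡⟨ ^-homo-* z M M ⟩
        z ^ M * z ^ M       ∎

    -- The determinant of the vectors (x, y) and (x′, y′): its minus sign is a plus in
    -- characteristic 2.
    det₂ : Carrier → Carrier → Carrier → Carrier → Carrier
    det₂ x y x′ y′ = x * y′ + x′ * y

    -- Binary quadratic forms

    module BinaryForm (A B C : Carrier) where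

      Q : Carrier → Carrier → Carrier
      Q x y = A * x * x + B * x * y + C * y * y

      private
        :Q : ∀ {k} → (A B C x y : Polynomial k) → Polynomial k
        :Q A B C x y = A ⊗ x ⊗ x ⊕ B ⊗ x ⊗ y ⊕ C ⊗ y ⊗ y

      Q-scale : ∀ l x y → Q (l * x) (l * y) ≡ l * l * Q x y
      Q-scale = solve₂ 6 (λ A B C l x y → :Q A B C (l ⊗ x) (l ⊗ y) ≔ l ⊗ l ⊗ :Q A B C x y) refl A B C

      -- The last summand is the polar form of Q. For B ≠ 0 it vanishes only on dependent pairs.
      Q-+ : ∀ x y x′ y′ → Q (x + x′) (y + y′) ≡ Q x y + Q x′ y′ + B * det₂ x y x′ y′
      Q-+ = solve₂ 7 (λ A B C x y x′ y′ → :Q A B C (x ⊕ x′) (y ⊕ y′) ≔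
        :Q A B C x y ⊕ :Q A B C x′ y′ ⊕ B ⊗ (x ⊗ y′ ⊕ x′ ⊗ y)) refl A B C

      Q-combination : ∀ l x y l′ x′ y′ → Q (l * x + l′ * x′) (l * y + l′ * y′) ≡
                      l * l * Q x y + l′ * l′ * Q x′ y′ + l * l′ * (B * det₂ x y x′ y′)
      Q-combination l x y l′ x′ y′ = begin
        Q (l * x + l′ * x′) (l * y + l′ * y′)
          ≡⟨ Q-+ _ _ _ _ ⟩
        Q (l * x) (l * y) + Q (l′ * x′) (l′ * y′) + B * det₂ (l * x) (l * y) (l′ * x′) (l′ * y′)
          ≡⟨ cong₂ _+_ (cong₂ _+_ (Q-scale l x y) (Q-scale l′ x′ y′))
               (solve₂ 7 (λ B l x y l′ x′ y′ → B ⊗ ((l ⊗ x) ⊗ (l′ ⊗ y′) ⊕ (l′ ⊗ x′) ⊗ (l ⊗ y)) ≔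
                  l ⊗ l′ ⊗ (B ⊗ (x ⊗ y′ ⊕ x′ ⊗ y))) refl B l x y l′ x′ y′) ⟩
        l * l * Q x y + l′ * l′ * Q x′ y′ + l * l′ * (B * det₂ x y x′ y′)
          ∎

      -- Cramer's identity d₂₃ p₁ + d₁₃ p₂ = d₁₂ p₃ writes the third vector through the other two.
      -- With Q(p₁) = Q(p₂) = 0 only the polar term survives on the left, so d₁₂² Q(p₃) = d₂₃ d₁₃ B
      -- d₁₂, a product of nonzero factors.
      three-zeros : ∀ {x₁ y₁ x₂ y₂ x₃ y₃} → B ≢ 0# →
        det₂ x₁ y₁ x₂ y₂ ≢ 0# → det₂ x₁ y₁ x₃ y₃ ≢ 0# → det₂ x₂ y₂ x₃ y₃ ≢ 0# →
        Q x₁ y₁ ≡ 0# → Q x₂ y₂ ≡ 0# → Q x₃ y₃ ≢ 0#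
      three-zeros {x₁} {y₁} {x₂} {y₂} {x₃} {y₃} B≢0 d₁₂≢0 d₁₃≢0 d₂₃≢0 Q₁≡0 Q₂≡0 Q₃≡0 =
        x*y≢0 (x*y≢0 d₂₃≢0 d₁₃≢0) (x*y≢0 B≢0 d₁₂≢0) (begin
          d₂₃ * d₁₃ * (B * d₁₂)
            ≡⟨ solve₂ 3 (λ d e z → z ≔ d ⊗ d ⊗ con₂ false ⊕ e ⊗ e ⊗ con₂ false ⊕ z) refl d₂₃ d₁₃ _ ⟩
          d₂₃ * d₂₃ * 0# + d₁₃ * d₁₃ * 0# + d₂₃ * d₁₃ * (B * d₁₂)
            ≡⟨ cong₂ (λ z w → d₂₃ * d₂₃ * z + d₁₃ * d₁₃ * w + d₂₃ * d₁₃ * (B * d₁₂)) Q₁≡0 Q₂≡0 ⟨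
          d₂₃ * d₂₃ * Q x₁ y₁ + d₁₃ * d₁₃ * Q x₂ y₂ + d₂₃ * d₁₃ * (B * d₁₂)
            ≡⟨ Q-combination d₂₃ x₁ y₁ d₁₃ x₂ y₂ ⟨
          Q (d₂₃ * x₁ + d₁₃ * x₂) (d₂₃ * y₁ + d₁₃ * y₂)
            ≡⟨ cong₂ Q
                 (solve₂ 6 (λ x₁ y₁ x₂ y₂ x₃ y₃ → (x₂ ⊗ y₃ ⊕ x₃ ⊗ y₂) ⊗ x₁ ⊕ (x₁ ⊗ y₃ ⊕ x₃ ⊗ y₁) ⊗ x₂ ≔
                    (x₁ ⊗ y₂ ⊕ x₂ ⊗ y₁) ⊗ x₃) refl x₁ y₁ x₂ y₂ x₃ y₃)
                 (solve₂ 6 (λ x₁ y₁ x₂ y₂ x₃ y₃ → (x₂ ⊗ y₃ ⊕ x₃ ⊗ y₂) ⊗ y₁ ⊕ (x₁ ⊗ y₃ ⊕ x₃ ⊗ y₁) ⊗ y₂ ≔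
                    (x₁ ⊗ y₂ ⊕ x₂ ⊗ y₁) ⊗ y₃) refl x₁ y₁ x₂ y₂ x₃ y₃) ⟩
          Q (d₁₂ * x₃) (d₁₂ * y₃)
            ≡⟨ Q-scale d₁₂ x₃ y₃ ⟩
          d₁₂ * d₁₂ * Q x₃ y₃
            ≡⟨ cong (d₁₂ * d₁₂ *_) Q₃≡0 ⟩
          d₁₂ * d₁₂ * 0#
            ≡⟨ zeroʳ _ ⟩
          0# ∎)
        where
        d₁₂ = det₂ x₁ y₁ x₂ y₂
        d₁₃ = det₂ x₁ y₁ x₃ y₃
        d₂₃ = det₂ x₂ y₂ x₃ y₃

      -- Over a common denominator B d, the vector v = (Q(p₂) p₁ + Q(p₁) p₂) / B d
      -- has Q(v) = Q(p₁) Q(p₂) Q(p₁ + p₂) / (B d)².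
      equidistant : ∀ {x₁ y₁ x₂ y₂} → B ≢ 0# → det₂ x₁ y₁ x₂ y₂ ≢ 0# →
        Q x₁ y₁ ≢ 0# → Q x₂ y₂ ≢ 0# → Q (x₁ + x₂) (y₁ + y₂) ≢ 0# →
        ∃₂ λ v w → Q v w ≢ 0# × Q (v + x₁) (w + y₁) ≡ Q v w × Q (v + x₂) (w + y₂) ≡ Q v w
      equidistant {x₁} {y₁} {x₂} {y₂} B≢0 d≢0 Q₁≢0 Q₂≢0 Q₁₂≢0 = v , w ,
        (λ Qvw≡0 → x*y≢0 (x*y≢0 (x*y≢0 i≢0 i≢0) (x*y≢0 Q₁≢0 Q₂≢0)) Q₁₂≢0 (trans (sym Qvw) Qvw≡0)) ,
        translate x₁ y₁ (begin
          B * det₂ v w x₁ y₁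
            ≡⟨ solve₂ 7 (λ B x₁ y₁ x₂ y₂ l m → B ⊗ ((l ⊗ x₁ ⊕ m ⊗ x₂) ⊗ y₁ ⊕ x₁ ⊗ (l ⊗ y₁ ⊕ m ⊗ y₂)) ≔
                 B ⊗ (x₁ ⊗ y₂ ⊕ x₂ ⊗ y₁) ⊗ m) refl B x₁ y₁ x₂ y₂ (i * Q₂) (i * Q₁) ⟩
          Bd * (i * Q₁)
            ≡⟨ cancel Q₁ ⟩
          Q₁ ∎) ,
        translate x₂ y₂ (begin
          B * det₂ v w x₂ y₂
            ≡⟨ solve₂ 7 (λ B x₁ y₁ x₂ y₂ l m → B ⊗ ((l ⊗ x₁ ⊕ m ⊗ x₂) ⊗ y₂ ⊕ x₂ ⊗ (l ⊗ y₁ ⊕ m ⊗ y₂)) ≔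
                 B ⊗ (x₁ ⊗ y₂ ⊕ x₂ ⊗ y₁) ⊗ l) refl B x₁ y₁ x₂ y₂ (i * Q₂) (i * Q₁) ⟩
          Bd * (i * Q₂)
            ≡⟨ cancel Q₂ ⟩
          Q₂ ∎)
        where
        Bd = B * det₂ x₁ y₁ x₂ y₂
        Q₁ = Q x₁ y₁
        Q₂ = Q x₂ y₂
        Bd≢0 = x*y≢0 B≢0 d≢0
        i = inverse Bd Bd≢0 .proj₁
        Bd*i≡1 = inverse Bd Bd≢0 .proj₂
        i≢0 = x*y≡1⇒y≢0 Bd*i≡1
        -- By `Q-+`, the equality Q(v + p) = Q(v) amounts to B det(v, p) = Q(p), which is linear in
        -- v. These coefficients are the Cramer solution of the two conditions for p₁ and p₂.
        v = i * Q₂ * x₁ + i * Q₁ * x₂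
        w = i * Q₂ * y₁ + i * Q₁ * y₂

        cancel : ∀ z → Bd * (i * z) ≡ z
        cancel z = begin
          Bd * (i * z) ≡⟨ *-assoc Bd i z ⟨
          Bd * i * z   ≡⟨ cong (_* z) Bd*i≡1 ⟩
          1# * z       ≡⟨ *-identityˡ z ⟩
          z            ∎

        Qvw : Q v w ≡ i * i * (Q₁ * Q₂) * Q (x₁ + x₂) (y₁ + y₂)
        Qvw = begin
          Q v w
            ≡⟨ Q-combination (i * Q₂) x₁ y₁ (i * Q₁) x₂ y₂ ⟩
          i * Q₂ * (i * Q₂) * Q₁ + i * Q₁ * (i * Q₁) * Q₂ + i * Q₂ * (i * Q₁) * Bd
            ≡⟨ solve₂ 4 (λ i Q₁ Q₂ Bd →
                 i ⊗ Q₂ ⊗ (i ⊗ Q₂) ⊗ Q₁ ⊕ i ⊗ Q₁ ⊗ (i ⊗ Q₁) ⊗ Q₂ ⊕ i ⊗ Q₂ ⊗ (i ⊗ Q₁) ⊗ Bd ≔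
                 i ⊗ i ⊗ (Q₁ ⊗ Q₂) ⊗ (Q₁ ⊕ Q₂ ⊕ Bd)) refl i Q₁ Q₂ Bd ⟩
          i * i * (Q₁ * Q₂) * (Q₁ + Q₂ + Bd)
            ≡⟨ cong (i * i * (Q₁ * Q₂) *_) (Q-+ x₁ y₁ x₂ y₂) ⟨
          i * i * (Q₁ * Q₂) * Q (x₁ + x₂) (y₁ + y₂)
            ∎

        translate : ∀ x y → B * det₂ v w x y ≡ Q x y → Q (v + x) (w + y) ≡ Q v w
        translate x y eq = begin
          Q (v + x) (w + y)                  ≡⟨ Q-+ v w x y ⟩
          Q v w + Q x y + B * det₂ v w x y   ≡⟨ cong (Q v w + Q x y +_) eq ⟩
          Q v w + Q x y + Q x y              ≡⟨ solve₂ 2 (λ x y → x ⊕ y ⊕ y ≔ x) refl (Q v w) (Q x y) ⟩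
          Q v w                              ∎

      -- Non-zeros of the form on the graph of a Frobenius power

      module FrobeniusGraph
        (M : ℕ) (^M-distrib-+ : ∀ x y → (x + y) ^ M ≡ x ^ M + y ^ M)
        {u : Carrier} (u≢0 : u ≢ 0#) (B≢0 : B ≢ 0#)
        {e : Carrier} (e^M≢e : e ^ M ≢ e)
        {ν₀ : Carrier} (ν₀^M≡ν₀ : ν₀ ^ M ≡ ν₀) (ν₀≢0 : ν₀ ≢ 0#) (ν₀≢1 : ν₀ ≢ 1#)
        where

        σ : Carrier → Carrier
        σ x = x ^ M

        Qᵘ : Carrier → Carrier
        Qᵘ s = Q s (σ s * u)

        det : Carrier → Carrier → Carrier
        det s s′ = det₂ s (σ s * u) s′ (σ s′ * u)

        Fixed : Carrier → Set
        Fixed ν = σ ν ≡ ν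

        -- Exactly what `equidistant` requires of the two graph vectors with parameters s and s′.
        IndependentNonZeros : Set
        IndependentNonZeros = ∃₂ λ s s′ → det s s′ ≢ 0# × Qᵘ s ≢ 0# × Qᵘ s′ ≢ 0# ×
                              Q (s + s′) (σ s * u + σ s′ * u) ≢ 0#

        1-fixed : Fixed 1#
        1-fixed = 1^k≡1 M

        0-fixed : Fixed 0#
        0-fixed = begin
          σ 0#         ≡⟨ cong σ (+-identityʳ 0#) ⟨
          σ (0# + 0#)  ≡⟨ ^M-distrib-+ 0# 0# ⟩
          σ 0# + σ 0#  ≡⟨ x+x≡0 (σ 0#) ⟩
          0#           ∎

        +-fixed : ∀ {ν ν′} → Fixed ν → Fixed ν′ → Fixed (ν + ν′)
        +-fixed fν fν′ = trans (^M-distrib-+ _ _) (cong₂ _+_ fν fν′)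

        σe+e≢0 : σ e + e ≢ 0#
        σe+e≢0 = e^M≢e ∘ x+y≡0⇒x≡y

        -- Given one non-zero g of Q on the graph, the parameters g(e + ν) with ν fixed by σ are
        -- chosen so that a sum of two of them is again a non-zero. It then remains only to find two
        -- values of ν at which Q itself does not vanish.
        module Pencil {g : Carrier} (Qᵘg≢0 : Qᵘ g ≢ 0#) where

          private
            g≢0 : g ≢ 0#
            g≢0 refl = Qᵘg≢0 (trans (cong (λ y → Q 0# (y * u)) 0-fixed)
              (solve₂ 4 (λ A B C u → A ⊗ con₂ false ⊗ con₂ false ⊕ B ⊗ con₂ false ⊗ (con₂ false ⊗ u)
                 ⊕ C ⊗ (con₂ false ⊗ u) ⊗ (con₂ false ⊗ u) ≔ con₂ false) refl A B C u))

          pencil : Carrier → Carrier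
          pencil ν = g * (e + ν)

          σ-pencil : ∀ {ν} → Fixed ν → σ (pencil ν) ≡ σ g * (σ e + ν)
          σ-pencil {ν} fν = begin
            σ (g * (e + ν))     ≡⟨ ^-distrib-* g (e + ν) M ⟩
            σ g * σ (e + ν)     ≡⟨ cong (σ g *_) (^M-distrib-+ e ν) ⟩
            σ g * (σ e + σ ν)   ≡⟨ cong (λ z → σ g * (σ e + z)) fν ⟩
            σ g * (σ e + ν)     ∎

          -- The determinant factors as g σ(g) u (σ(e) + e)(ν + ν′); the fourth factor is nonzero
          -- because σ moves e.
          det-pencil : ∀ {ν ν′} → Fixed ν → Fixed ν′ → ν + ν′ ≢ 0# → det (pencil ν) (pencil ν′) ≢ 0#
          det-pencil {ν} {ν′} fν fν′ ν+ν′≢0 = subst (_≢ 0#) (sym (begin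
            det (pencil ν) (pencil ν′)
              ≡⟨ cong₂ (λ y y′ → det₂ (pencil ν) (y * u) (pencil ν′) (y′ * u)) (σ-pencil fν) (σ-pencil fν′) ⟩
            det₂ (pencil ν) (σ g * (σ e + ν) * u) (pencil ν′) (σ g * (σ e + ν′) * u)
              ≡⟨ solve₂ 7 (λ g g′ e e′ ν ν′ u →
                   g ⊗ (e ⊕ ν) ⊗ (g′ ⊗ (e′ ⊕ ν′) ⊗ u) ⊕ g ⊗ (e ⊕ ν′) ⊗ (g′ ⊗ (e′ ⊕ ν) ⊗ u) ≔
                   g ⊗ g′ ⊗ u ⊗ (e′ ⊕ e) ⊗ (ν ⊕ ν′)) refl g (σ g) e (σ e) ν ν′ u ⟩
            g * σ g * u * (σ e + e) * (ν + ν′)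
              ∎))
            (x*y≢0 (x*y≢0 (x*y≢0 (x*y≢0 g≢0 (x^k≢0 M g≢0)) u≢0) σe+e≢0) ν+ν′≢0)

          Zero : Carrier → Set
          Zero ν = Qᵘ (pencil ν) ≡ 0#

          three : ∀ {ν₁ ν₂ ν₃} → Fixed ν₁ → Fixed ν₂ → Fixed ν₃ →
                  ν₁ + ν₂ ≢ 0# → ν₁ + ν₃ ≢ 0# → ν₂ + ν₃ ≢ 0# →
                  Zero ν₁ → Zero ν₂ → ¬ Zero ν₃
          three f₁ f₂ f₃ d₁₂ d₁₃ d₂₃ =
            three-zeros B≢0 (det-pencil f₁ f₂ d₁₂) (det-pencil f₁ f₃ d₁₃) (det-pencil f₂ f₃ d₂₃)

          -- Two members of the pencil differ by a fixed multiple of g.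
          two : ∀ {ν ν′} → Fixed ν → Fixed ν′ → ν + ν′ ≢ 0# → ¬ Zero ν → ¬ Zero ν′ → IndependentNonZeros
          two {ν} {ν′} fν fν′ ν+ν′≢0 ¬zν ¬zν′ = pencil ν , pencil ν′ , det-pencil fν fν′ ν+ν′≢0 , ¬zν , ¬zν′ ,
            subst (_≢ 0#) (sym (begin
              Q (pencil ν + pencil ν′) (σ (pencil ν) * u + σ (pencil ν′) * u)
                ≡⟨ cong₂ Q (solve₂ 4 (λ g e ν ν′ → g ⊗ (e ⊕ ν) ⊕ g ⊗ (e ⊕ ν′) ≔ (ν ⊕ ν′) ⊗ g) refl g e ν ν′)
                     (trans (cong₂ (λ y y′ → y * u + y′ * u) (σ-pencil fν) (σ-pencil fν′))
                       (solve₂ 5 (λ g e ν ν′ u → g ⊗ (e ⊕ ν) ⊗ u ⊕ g ⊗ (e ⊕ ν′) ⊗ u ≔ (ν ⊕ ν′) ⊗ (g ⊗ u)) refl (σ g) (σ e) ν ν′ u)) ⟩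
              Q ((ν + ν′) * g) ((ν + ν′) * (σ g * u))
                ≡⟨ Q-scale (ν + ν′) g (σ g * u) ⟩
              (ν + ν′) * (ν + ν′) * Qᵘ g
                ∎))
            (x*y≢0 (x*y≢0 ν+ν′≢0 ν+ν′≢0) Qᵘg≢0)

          -- The scalars 0, 1, ν₀ and 1 + ν₀ are fixed and pairwise distinct. By `three` at most two
          -- of them give zeros of Q, so two others are available for `two`.
          result : IndependentNonZeros
          result = go (zero? 0#) (zero? 1#) (zero? ν₀) (zero? (1# + ν₀))
            where
            zero? : ∀ ν → Dec (Zero ν)
            zero? ν = Qᵘ (pencil ν) ≟ 0#

            f₀ = 0-fixed
            f₁ = 1-fixed
            f₂ : Fixed ν₀
            f₂ = ν₀^M≡ν₀
            f₃ : Fixed (1# + ν₀)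
            f₃ = +-fixed f₁ f₂
            d₀₁ : 0# + 1# ≢ 0#
            d₀₁ = subst (_≢ 0#) (sym (+-identityˡ _)) 1#≢0#
            d₀₂ : 0# + ν₀ ≢ 0#
            d₀₂ = subst (_≢ 0#) (sym (+-identityˡ _)) ν₀≢0
            d₁₂ : 1# + ν₀ ≢ 0#
            d₁₂ eq = ν₀≢1 (sym (x+y≡0⇒x≡y eq))
            d₀₃ : 0# + (1# + ν₀) ≢ 0#
            d₀₃ = subst (_≢ 0#) (sym (+-identityˡ _)) d₁₂
            d₁₃ : 1# + (1# + ν₀) ≢ 0#
            d₁₃ = subst (_≢ 0#) (solve₂ 1 (λ x → x ≔ con₂ true ⊕ (con₂ true ⊕ x)) refl ν₀) ν₀≢0
            d₂₃ : ν₀ + (1# + ν₀) ≢ 0#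
            d₂₃ = subst (_≢ 0#) (solve₂ 1 (λ x → con₂ true ≔ x ⊕ (con₂ true ⊕ x)) refl ν₀) 1#≢0#

            go : Dec (Zero 0#) → Dec (Zero 1#) → Dec (Zero ν₀) → Dec (Zero (1# + ν₀)) → IndependentNonZeros
            go (no  n₀) (no  n₁) _        _        = two f₀ f₁ d₀₁ n₀ n₁
            go (no  n₀) (yes _)  (no  n₂) _        = two f₀ f₂ d₀₂ n₀ n₂
            go (no  n₀) (yes _)  (yes _)  (no  n₃) = two f₀ f₃ d₀₃ n₀ n₃
            go (no  _)  (yes z₁) (yes z₂) (yes z₃) = contradiction z₃ (three f₁ f₂ f₃ d₁₂ d₁₃ d₂₃ z₁ z₂)
            go (yes _)  (no  n₁) (no  n₂) _        = two f₁ f₂ d₁₂ n₁ n₂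
            go (yes _)  (no  n₁) (yes _)  (no  n₃) = two f₁ f₃ d₁₃ n₁ n₃
            go (yes z₀) (no  _)  (yes z₂) (yes z₃) = contradiction z₃ (three f₀ f₂ f₃ d₀₂ d₀₃ d₂₃ z₀ z₂)
            go (yes _)  (yes _)  (no  n₂) (no  n₃) = two f₂ f₃ d₂₃ n₂ n₃
            go (yes z₀) (yes z₁) (no  _)  (yes z₃) = contradiction z₃ (three f₀ f₁ f₃ d₀₁ d₀₃ d₁₃ z₀ z₁)
            go (yes z₀) (yes z₁) (yes z₂) _        = contradiction z₂ (three f₀ f₁ f₂ d₀₁ d₀₂ d₁₂ z₀ z₁)

        -- A starting point g is found among 1, e and 1 + e: the three graph vectors have all their
        -- pairwise determinants equal to (σ(e) + e) u, hence nonzero, so `three-zeros` forbids Q to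
        -- vanish at all of them.
        independentNonZeros : IndependentNonZeros
        independentNonZeros with Qᵘ 1# ≟ 0# | Qᵘ e ≟ 0# | Qᵘ (1# + e) ≟ 0#
        ... | no n  | _     | _     = Pencil.result n
        ... | yes _ | no n  | _     = Pencil.result n
        ... | yes _ | yes _ | no n  = Pencil.result n
        ... | yes z₁ | yes z₂ | yes z₃ = contradiction z₃ (three-zeros B≢0
          (nonzero (begin
            1# * (σ e * u) + e * (σ 1# * u)
              ≡⟨ cong (λ z → 1# * (σ e * u) + e * (z * u)) 1-fixed ⟩
            1# * (σ e * u) + e * (1# * u)
              ≡⟨ solve₂ 3 (λ e e′ u → con₂ true ⊗ (e′ ⊗ u) ⊕ e ⊗ (con₂ true ⊗ u) ≔ (e′ ⊕ e) ⊗ u) refl e (σ e) u ⟩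
            (σ e + e) * u ∎))
          (nonzero (begin
            1# * (σ (1# + e) * u) + (1# + e) * (σ 1# * u)
              ≡⟨ cong₂ (λ y z → 1# * (y * u) + (1# + e) * (z * u)) σ[1+e] 1-fixed ⟩
            1# * ((1# + σ e) * u) + (1# + e) * (1# * u)
              ≡⟨ solve₂ 3 (λ e e′ u → con₂ true ⊗ ((con₂ true ⊕ e′) ⊗ u) ⊕ (con₂ true ⊕ e) ⊗ (con₂ true ⊗ u) ≔ (e′ ⊕ e) ⊗ u) refl e (σ e) u ⟩
            (σ e + e) * u ∎))
          (nonzero (begin
            e * (σ (1# + e) * u) + (1# + e) * (σ e * u)
              ≡⟨ cong (λ y → e * (y * u) + (1# + e) * (σ e * u)) σ[1+e] ⟩
            e * ((1# + σ e) * u) + (1# + e) * (σ e * u)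
              ≡⟨ solve₂ 3 (λ e e′ u → e ⊗ ((con₂ true ⊕ e′) ⊗ u) ⊕ (con₂ true ⊕ e) ⊗ (e′ ⊗ u) ≔ (e′ ⊕ e) ⊗ u) refl e (σ e) u ⟩
            (σ e + e) * u ∎))
          z₁ z₂)
          where
          σ[1+e] : σ (1# + e) ≡ 1# + σ e
          σ[1+e] = trans (^M-distrib-+ 1# e) (cong (_+ σ e) 1-fixed)
          nonzero : ∀ {x} → x ≡ (σ e + e) * u → x ≢ 0#
          nonzero refl = x*y≢0 σe+e≢0 u≢0

-- Numerical facts about the norm exponent

-- The identity (q - 1) S = qᵗ - 1, arranged to avoid subtraction.
geometric-sum : ∀ q t → q ℕ.* sum (map (q ℕ.^_) (upTo t)) ℕ.+ 1 ≡ sum (map (q ℕ.^_) (upTo t)) ℕ.+ q ℕ.^ t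
geometric-sum q zero    = trans (cong (ℕ._+ 1) (ℕ.*-zeroʳ q)) refl
geometric-sum q (suc t) = begin
  q ℕ.* sum (map (q ℕ.^_) (upTo (suc t))) ℕ.+ 1 ≡⟨ cong (λ S → q ℕ.* S ℕ.+ 1) S-suc ⟩
  q ℕ.* (S ℕ.+ q ℕ.^ t) ℕ.+ 1                    ≡⟨ shuffle q S (q ℕ.^ t) ⟩
  (q ℕ.* S ℕ.+ 1) ℕ.+ q ℕ.^ suc t                ≡⟨ cong (ℕ._+ q ℕ.^ suc t) (geometric-sum q t) ⟩
  S ℕ.+ q ℕ.^ t ℕ.+ q ℕ.^ suc t                    ≡⟨ cong (ℕ._+ q ℕ.^ suc t) S-suc ⟨
  sum (map (q ℕ.^_) (upTo (suc t))) ℕ.+ q ℕ.^ suc t ∎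
  where
  open ≡-Reasoning
  S = sum (map (q ℕ.^_) (upTo t))
  S-suc : sum (map (q ℕ.^_) (upTo (suc t))) ≡ S ℕ.+ q ℕ.^ t
  S-suc = begin
    sum (map (q ℕ.^_) (upTo (suc t)))         ≡⟨ cong (λ ks → sum (map (q ℕ.^_) ks)) (upTo-∷ʳ t) ⟨
    sum (map (q ℕ.^_) (upTo t ∷ʳ t))          ≡⟨ cong sum (map-++ (q ℕ.^_) (upTo t) (t List.∷ List.[])) ⟩
    sum (map (q ℕ.^_) (upTo t) ∷ʳ q ℕ.^ t)      ≡⟨ sum-++ (map (q ℕ.^_) (upTo t)) (q ℕ.^ t List.∷ List.[]) ⟩
    S ℕ.+ (q ℕ.^ t ℕ.+ 0)                     ≡⟨ cong (S ℕ.+_) (ℕ.+-identityʳ (q ℕ.^ t)) ⟩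
    S ℕ.+ q ℕ.^ t                             ∎
  shuffle : ∀ q S r → q ℕ.* (S ℕ.+ r) ℕ.+ 1 ≡ (q ℕ.* S ℕ.+ 1) ℕ.+ q ℕ.* r
  shuffle = solve-∀

geometric-sum-pos : ∀ q {t} → 1 ℕ.≤ t → 1 ℕ.≤ sum (map (q ℕ.^_) (upTo t))
geometric-sum-pos q (ℕ.s≤s _) = ℕ.s≤s ℕ.z≤n

-- With q ≥ 3 the identity above gives qᵗ ≥ 2S + 1, and S ≥ 1 makes this at least S + 2. The bound
-- lets `∃x^k≢x` be applied to the exponent S + 1.
1+geometric-sum<qᵗ : ∀ {q t} → 1 ℕ.≤ t → 3 ℕ.≤ q → suc (sum (map (q ℕ.^_) (upTo t))) ℕ.< q ℕ.^ t
1+geometric-sum<qᵗ {q} {t} 1≤t 3≤q = ℕ.+-cancelˡ-≤ S _ _ (begin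
  S ℕ.+ suc (suc S)     ≡⟨ rearrange₁ S ⟩
  suc (S ℕ.+ S) ℕ.+ 1   ≤⟨ ℕ.+-monoʳ-≤ (suc (S ℕ.+ S)) (geometric-sum-pos q 1≤t) ⟩
  suc (S ℕ.+ S) ℕ.+ S   ≡⟨ rearrange₂ S ⟩
  3 ℕ.* S ℕ.+ 1         ≤⟨ ℕ.+-monoˡ-≤ 1 (ℕ.*-monoˡ-≤ S 3≤q) ⟩
  q ℕ.* S ℕ.+ 1         ≡⟨ geometric-sum q t ⟩
  S ℕ.+ q ℕ.^ t         ∎)
  where
  open ℕ.≤-Reasoning
  S = sum (map (q ℕ.^_) (upTo t))
  rearrange₁ : ∀ S → S ℕ.+ suc (suc S) ≡ suc (S ℕ.+ S) ℕ.+ 1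
  rearrange₁ = solve-∀
  rearrange₂ : ∀ S → suc (S ℕ.+ S) ℕ.+ S ≡ 3 ℕ.* S ℕ.+ 1
  rearrange₂ = solve-∀

∣-^ : ∀ {d q t} → 1 ℕ.≤ t → d ∣ q → d ∣ q ℕ.^ t
∣-^ {q = q} {suc t} _ d∣q = ℕ.∣m⇒∣m*n (q ℕ.^ t) d∣q

even-primePower : ∀ {q} → IsPrimePower q → 2 ∣ q → ∃ λ h → q ≡ 2 ℕ.^ h
even-primePower {q} (p , h , p-prime , _ , refl) 2∣q = h , cong (ℕ._^ h) (2∣pᵏ⇒p≡2 h 2∣q)
  where
  2∣pᵏ⇒p≡2 : ∀ k → 2 ∣ p ℕ.^ k → p ≡ 2
  2∣pᵏ⇒p≡2 zero    2∣1 = contradiction (ℕ.∣1⇒≡1 2∣1) λ ()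
  2∣pᵏ⇒p≡2 (suc k) 2∣pᵏ⁺¹ with euclidsLemma p (p ℕ.^ k) prime[2] 2∣pᵏ⁺¹
  ... | inj₂ 2∣pᵏ = 2∣pᵏ⇒p≡2 k 2∣pᵏ
  ... | inj₁ 2∣p with prime⇒irreducible p-prime 2∣p
  ...   | inj₂ 2≡p = sym 2≡p

-- Norms and Frobenius powers in the field of order qᵗ

module EvenGeometry
  (q t : ℕ) (q-primePower : IsPrimePower q) (2∣q : 2 ∣ q) (3≤t : 3 ℕ.≤ t) (3≤q : 3 ℕ.≤ q)
  (K : FiniteField (q ℕ.^ t))
  where

  open FiniteField K
  open Geometry q t K hiding (X)
  open FiniteFieldProperties K
  open ≡-Reasoning

  private
    1≤t : 1 ℕ.≤ t
    1≤t = ℕ.≤-trans (ℕ.s≤s ℕ.z≤n) 3≤t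

    2∣qᵗ : 2 ∣ q ℕ.^ t
    2∣qᵗ = ∣-^ 1≤t 2∣q

  open Characteristic2 (even⇒1+1≡0 2∣qᵗ)

  -- Here q = 2ʰ, so the exponent is 2^(hm).
  ^qᵐ-distrib-+ : ∀ m x y → (x + y) ^ (q ℕ.^ m) ≡ x ^ (q ℕ.^ m) + y ^ (q ℕ.^ m)
  ^qᵐ-distrib-+ m x y with h , q≡2ʰ ← even-primePower q-primePower 2∣q =
    subst (λ M → (x + y) ^ M ≡ x ^ M + y ^ M)
      (trans (sym (ℕ.^-*-assoc 2 h m)) (cong (ℕ._^ m) (sym q≡2ʰ)))
      (^2^-distrib-+ (h ℕ.* m) x y)

  N-distrib-* : ∀ x y → N (x * y) ≡ N x * N y
  N-distrib-* x y = ^-distrib-* x y normExponent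

  -- `geometric-sum` and `fermat` give x N(x)^q = N(x) x^(qᵗ) = N(x) x, and x cancels.
  N-^q : ∀ {x} → x ≢ 0# → N x ^ q ≡ N x
  N-^q {x} x≢0 = *-cancelˡ-≢0 x≢0 (begin
    x * N x ^ q                         ≡⟨ cong (x *_) (^-swap x normExponent q) ⟩
    x * (x ^ q) ^ normExponent         ≡⟨ cong (x *_) (^-assocʳ x q normExponent) ⟩
    x ^ suc (q ℕ.* normExponent)        ≡⟨ cong (x ^_) (trans (sym (ℕ.+-comm _ 1)) (geometric-sum q t)) ⟩
    x ^ (normExponent ℕ.+ q ℕ.^ t)        ≡⟨ ^-homo-* x normExponent (q ℕ.^ t) ⟩
    N x * x ^ (q ℕ.^ t)                   ≡⟨ cong (N x *_) (fermat x) ⟩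
    N x * x                              ≡⟨ *-comm _ _ ⟩
    x * N x                              ∎)

  N-^qᵐ : ∀ m {x} → x ≢ 0# → N (x ^ (q ℕ.^ m)) ≡ N x
  N-^qᵐ m {x} x≢0 = trans (^-swap x (q ℕ.^ m) normExponent) (^-fixed m (N-^q x≢0))

  -- The witness is a norm: norms lie in 𝔽_q, and they are not all 0 or 1.
  ∃-nontrivial-fixed : ∀ m → ∃ λ ν → ν ^ (q ℕ.^ m) ≡ ν × ν ≢ 0# × ν ≢ 1#
  -- The exponent is one more than that of the norm: x N(x) ≠ x says at once that x ≠ 0 and N(x) ≠
  -- 1.
  ∃-nontrivial-fixed m with x , x¹⁺ᴱ≢x ← ∃x^k≢x (ℕ.s≤s (geometric-sum-pos q 1≤t)) (1+geometric-sum<qᵗ 1≤t 3≤q) =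
    N x , ^-fixed m (N-^q x≢0) , x^k≢0 normExponent x≢0 ,
    λ Nx≡1 → x¹⁺ᴱ≢x (trans (cong (x *_) Nx≡1) (*-identityʳ x))
    where
    x≢0 : x ≢ 0#
    x≢0 refl = x¹⁺ᴱ≢x (zeroˡ _)

  -- The bounds on m give 2 ≤ q^m < qᵗ, so x^(q^m) - x has too low a degree to vanish on the whole
  -- field.
  ∃-nonfixed : ∀ {m} → 1 ℕ.≤ m → m ℕ.< t → ∃ λ e → e ^ (q ℕ.^ m) ≢ e
  ∃-nonfixed {m} 1≤m m<t = ∃x^k≢x
    (ℕ.≤-trans (ℕ.n<1+n 1) (ℕ.≤-trans (ℕ.<⇒≤ 3≤q)
      (subst (ℕ._≤ q ℕ.^ m) (ℕ.^-identityʳ q) (ℕ.^-monoʳ-≤ q {{ℕ.>-nonZero (ℕ.<⇒≤ (ℕ.<⇒≤ 3≤q))}} 1≤m))))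
    (ℕ.^-monoʳ-< q (ℕ.<⇒≤ 3≤q) m<t)

  -- Conics not tangent to the line at infinity, and their nuclei

  parallel⇒∼ : ∀ {x y x′ y′} → det₂ x y x′ y′ ≡ 0# →
    (x ∷ y ∷ 0# ∷ []) ≢ 0ᵛ → (x′ ∷ y′ ∷ 0# ∷ []) ≢ 0ᵛ → (x ∷ y ∷ 0# ∷ []) ∼ (x′ ∷ y′ ∷ 0# ∷ [])
  -- The scalar is the ratio of the first coordinates, or of the second ones when x = 0.
  parallel⇒∼ {x} {y} {x′} {y′} d≡0 v≢0 v′≢0 with x ≟ 0#
  ... | no x≢0 = k , k≢0 , cong₂ _∷_ x′≡kx (cong₂ _∷_ y′≡ky (cong (_∷ []) (sym (zeroʳ k))))
    where
    x⁻¹ = inverse x x≢0 .proj₁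
    k = x⁻¹ * x′
    x*k : x * k ≡ x′
    x*k = begin
      x * (x⁻¹ * x′) ≡⟨ *-assoc x x⁻¹ x′ ⟨
      x * x⁻¹ * x′   ≡⟨ cong (_* x′) (inverse x x≢0 .proj₂) ⟩
      1# * x′        ≡⟨ *-identityˡ x′ ⟩
      x′             ∎
    x′≡kx : x′ ≡ k * x
    x′≡kx = trans (sym x*k) (*-comm x k)
    y′≡ky : y′ ≡ k * y
    y′≡ky = *-cancelˡ-≢0 x≢0 (begin
      x * y′       ≡⟨ x+y≡0⇒x≡y d≡0 ⟩
      x′ * y       ≡⟨ cong (_* y) x*k ⟨
      x * k * y    ≡⟨ *-assoc x k y ⟩
      x * (k * y)  ∎)
    k≢0 : k ≢ 0#
    k≢0 k≡0 = v′≢0 (cong₂ _∷_ (trans x′≡kx (trans (cong (_* x) k≡0) (zeroˡ x)))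
      (cong (_∷ 0# ∷ []) (trans y′≡ky (trans (cong (_* y) k≡0) (zeroˡ y)))))
  ... | yes refl = k , k≢0 , cong₂ _∷_ (trans x′≡0 (sym (zeroʳ k))) (cong₂ _∷_ y′≡ky (cong (_∷ []) (sym (zeroʳ k))))
    where
    y≢0 : y ≢ 0#
    y≢0 y≡0 = v≢0 (cong (λ z → 0# ∷ z ∷ 0# ∷ []) y≡0)
    y⁻¹ = inverse y y≢0 .proj₁
    k = y⁻¹ * y′
    x′≡0 : x′ ≡ 0#
    x′≡0 = x*y≡0⇒y≡0 y≢0 (trans (solve₂ 3 (λ y x′ y′ → y ⊗ x′ ≔ con₂ false ⊗ y′ ⊕ x′ ⊗ y) refl y x′ y′) d≡0)
    y′≡ky : y′ ≡ k * y
    y′≡ky = sym (begin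
      y⁻¹ * y′ * y   ≡⟨ solve₂ 3 (λ i y y′ → i ⊗ y′ ⊗ y ≔ y ⊗ i ⊗ y′) refl y⁻¹ y y′ ⟩
      y * y⁻¹ * y′   ≡⟨ cong (_* y′) (inverse y y≢0 .proj₂) ⟩
      1# * y′        ≡⟨ *-identityˡ y′ ⟩
      y′             ∎)
    k≢0 : k ≢ 0#
    k≢0 k≡0 = v′≢0 (cong₂ _∷_ x′≡0 (cong (_∷ 0# ∷ []) (trans y′≡ky (trans (cong (_* y) k≡0) (zeroˡ y)))))

  private
    :eval : ∀ {k} (a b c f g h x y z : Polynomial k) → Polynomial k
    :eval a b c f g h x y z =
      a ⊗ x ⊗ x ⊕ b ⊗ y ⊗ y ⊕ c ⊗ z ⊗ z ⊕ f ⊗ y ⊗ z ⊕ g ⊗ x ⊗ z ⊕ h ⊗ x ⊗ y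

    :polar : ∀ {k} (a b c f g h x y z x′ y′ z′ : Polynomial k) → Polynomial k
    :polar a b c f g h x y z x′ y′ z′ =
      :eval a b c f g h (x ⊕ x′) (y ⊕ y′) (z ⊕ z′) ⊖ :eval a b c f g h x y z ⊖ :eval a b c f g h x′ y′ z′

  -- The form is z(cz + fy + gx). It vanishes at (f, g, 0), which lies in the radical of the polar
  -- form, so nondegeneracy gives g = 0. Then (1, 0, 0) is also a zero in the radical, and it is not
  -- the zero vector.
  linePair-degenerate : ∀ {a b c f g h} → a ≡ 0# → b ≡ 0# → h ≡ 0# →
    ¬ QuadraticForm.NonDegenerate (record { a = a; b = b; c = c; f = f; g = g; h = h })
  linePair-degenerate {c = c} {f} {g} refl refl refl nd = 1#≢0# (Vec.∷-injectiveˡ (nd (1# ∷ 0# ∷ 0# ∷ [])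
    (solve₂ 3 (λ c f g → :eval o o c f g o (con₂ true) o o ≔ o) refl c f g)
    λ where
      (x ∷ y ∷ z ∷ []) → begin
        QuadraticForm.polar form (1# ∷ 0# ∷ 0# ∷ []) (x ∷ y ∷ z ∷ [])
          ≡⟨ solve₂ 6 (λ c f g x y z → :polar o o c f g o (con₂ true) o o x y z ≔ g ⊗ z) refl c f g x y z ⟩
        g * z   ≡⟨ cong (_* z) g≡0 ⟩
        0# * z  ≡⟨ zeroˡ z ⟩
        0#      ∎))
    where
    form : QuadraticForm
    form = record { a = 0#; b = 0#; c = c; f = f; g = g; h = 0# }
    o : ∀ {k} → Polynomial k
    o = con₂ false
    g≡0 : g ≡ 0#
    g≡0 = Vec.∷-injectiveˡ (Vec.∷-injectiveʳ (nd (f ∷ g ∷ 0# ∷ [])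
      (solve₂ 3 (λ c f g → :eval o o c f g o f g o ≔ o) refl c f g)
      λ where
        (x ∷ y ∷ z ∷ []) → solve₂ 6 (λ c f g x y z → :polar o o c f g o f g o x y z ≔ o) refl c f g x y z))

  -- If h = 0 the form restricts to (αx + βy)² on ℓ∞, so ℓ∞ would be a tangent
  -- line or part of the conic.
  ¬tangent⇒h≢0 : (𝒞 : Conic) → Exterior ℓ∞ 𝒞 ⊎ Secant ℓ∞ 𝒞 → QuadraticForm.h (Conic.form 𝒞) ≢ 0#
  ¬tangent⇒h≢0 record { form = record { a = a; b = b; c = c; f = f; g = g; h = h } ; nonDegenerate = nd } = go
    where
    o : ∀ {k} → Polynomial k
    o = con₂ false
    form : QuadraticForm
    form = record { a = a; b = b; c = c; f = f; g = g; h = h }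
    𝒞 : Conic
    𝒞 = record { form = form ; nonDegenerate = nd }
    α β : Carrier
    α = even⇒square 2∣qᵗ a .proj₁
    β = even⇒square 2∣qᵗ b .proj₁
    α²≡a : α * α ≡ a
    α²≡a = even⇒square 2∣qᵗ a .proj₂
    β²≡b : β * β ≡ b
    β²≡b = even⇒square 2∣qᵗ b .proj₂

    eval-ℓ∞ : h ≡ 0# → ∀ x y → QuadraticForm.eval form (x ∷ y ∷ 0# ∷ []) ≡ (α * x + β * y) * (α * x + β * y)
    eval-ℓ∞ h≡0 x y = begin
      QuadraticForm.eval form (x ∷ y ∷ 0# ∷ [])
        ≡⟨ solve₂ 8 (λ a b c f g h x y → :eval a b c f g h x y o ≔ a ⊗ x ⊗ x ⊕ b ⊗ y ⊗ y ⊕ h ⊗ x ⊗ y) refl a b c f g h x y ⟩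
      a * x * x + b * y * y + h * x * y
        ≡⟨ cong₂ _+_ (cong₂ (λ a b → a * x * x + b * y * y) (sym α²≡a) (sym β²≡b)) (cong (λ h → h * x * y) h≡0) ⟩
      α * α * x * x + β * β * y * y + 0# * x * y
        ≡⟨ solve₂ 4 (λ α β x y → α ⊗ α ⊗ x ⊗ x ⊕ β ⊗ β ⊗ y ⊗ y ⊕ o ⊗ x ⊗ y ≔ (α ⊗ x ⊕ β ⊗ y) ⊗ (α ⊗ x ⊕ β ⊗ y)) refl α β x y ⟩
      (α * x + β * y) * (α * x + β * y)
        ∎

    go : Exterior ℓ∞ 𝒞 ⊎ Secant ℓ∞ 𝒞 → h ≢ 0#
    -- The conic would contain (β, α, 0). If α = 0 these coordinates might all vanish, and (1, 0, 0)
    -- takes their place.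
    go (inj₁ exterior) h≡0 with α ≟ 0#
    ... | yes α≡0 = exterior ((1# ∷ 0# ∷ 0# ∷ []) , 1#≢0# ∘ Vec.∷-injectiveˡ) refl (begin
      QuadraticForm.eval form (1# ∷ 0# ∷ 0# ∷ [])      ≡⟨ eval-ℓ∞ h≡0 1# 0# ⟩
      (α * 1# + β * 0#) * (α * 1# + β * 0#)            ≡⟨ cong (λ α → (α * 1# + β * 0#) * (α * 1# + β * 0#)) α≡0 ⟩
      (0# * 1# + β * 0#) * (0# * 1# + β * 0#)          ≡⟨ solve₂ 1 (λ β → (o ⊗ con₂ true ⊕ β ⊗ o) ⊗ (o ⊗ con₂ true ⊕ β ⊗ o) ≔ o) refl β ⟩
      0#                                               ∎)
    ... | no  α≢0 = exterior ((β ∷ α ∷ 0# ∷ []) , α≢0 ∘ Vec.∷-injectiveˡ ∘ Vec.∷-injectiveʳ) refl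
      (trans (eval-ℓ∞ h≡0 β α) (solve₂ 2 (λ α β → (α ⊗ β ⊕ β ⊗ α) ⊗ (α ⊗ β ⊕ β ⊗ α) ≔ o) refl α β))
    -- Two independent roots of the linear form αx + βy force α = β = 0, so that z divides the whole
    -- form.
    go (inj₂ (((x ∷ y ∷ z ∷ []) , v≢0) , ((x′ ∷ y′ ∷ z′ ∷ []) , v′≢0) , (refl , on) , (refl , on′) , v≁v′ , _)) h≡0 =
      linePair-degenerate
        (trans (sym α²≡a) (trans (cong (_* α) α≡0) (zeroˡ α)))
        (trans (sym β²≡b) (trans (cong (_* β) β≡0) (zeroˡ β)))
        h≡0 nd
      where
      d≢0 : det₂ x y x′ y′ ≢ 0#
      d≢0 d≡0 = v≁v′ (parallel⇒∼ d≡0 v≢0 v′≢0)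
      root : α * x + β * y ≡ 0#
      root = x*x≡0⇒x≡0 (trans (sym (eval-ℓ∞ h≡0 x y)) on)
      root′ : α * x′ + β * y′ ≡ 0#
      root′ = x*x≡0⇒x≡0 (trans (sym (eval-ℓ∞ h≡0 x′ y′)) on′)
      α≡0 : α ≡ 0#
      α≡0 = x*y≡0⇒y≡0 d≢0 (begin
        det₂ x y x′ y′ * α
          ≡⟨ solve₂ 6 (λ x y x′ y′ α β → (x ⊗ y′ ⊕ x′ ⊗ y) ⊗ α ≔ y′ ⊗ (α ⊗ x ⊕ β ⊗ y) ⊕ y ⊗ (α ⊗ x′ ⊕ β ⊗ y′)) refl x y x′ y′ α β ⟩
        y′ * (α * x + β * y) + y * (α * x′ + β * y′)
          ≡⟨ cong₂ (λ r r′ → y′ * r + y * r′) root root′ ⟩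
        y′ * 0# + y * 0#
          ≡⟨ solve₂ 2 (λ y y′ → y′ ⊗ o ⊕ y ⊗ o ≔ o) refl y y′ ⟩
        0# ∎)
      β≡0 : β ≡ 0#
      β≡0 = x*y≡0⇒y≡0 d≢0 (begin
        det₂ x y x′ y′ * β
          ≡⟨ solve₂ 6 (λ x y x′ y′ α β → (x ⊗ y′ ⊕ x′ ⊗ y) ⊗ β ≔ x′ ⊗ (α ⊗ x ⊕ β ⊗ y) ⊕ x ⊗ (α ⊗ x′ ⊕ β ⊗ y′)) refl x y x′ y′ α β ⟩
        x′ * (α * x + β * y) + x * (α * x′ + β * y′)
          ≡⟨ cong₂ (λ r r′ → x′ * r + x * r′) root root′ ⟩
        x′ * 0# + x * 0#
          ≡⟨ solve₂ 2 (λ y y′ → y′ ⊗ o ⊕ y ⊗ o ≔ o) refl x x′ ⟩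
        0# ∎)

  -- (n₁, n₂, 1) is the nucleus of the conic.
  nucleus-radical : ∀ {a b c h n₁ n₂} w →
    QuadraticForm.polar (record { a = a; b = b; c = c; f = h * n₁; g = h * n₂; h = h })
      (n₁ ∷ n₂ ∷ 1# ∷ []) w ≡ 0#
  nucleus-radical {a} {b} {c} {h} {n₁} {n₂} (x ∷ y ∷ z ∷ []) =
    solve₂ 9 (λ a b c h n₁ n₂ x y z → :polar a b c (h ⊗ n₁) (h ⊗ n₂) h n₁ n₂ (con₂ true) x y z ≔ con₂ false)
      refl a b c h n₁ n₂ x y z

  -- Three points of the conic on one block

  module BlockConstruction
    (form : QuadraticForm) (nonDegenerate : QuadraticForm.NonDegenerate form)
    (h≢0 : QuadraticForm.h form ≢ 0#)
    (φ : Matrix) (detφ≢0 : det φ ≢ 0#)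
    {θ : Carrier} (θ≢0 : θ ≢ 0#)
    {m : ℕ} (1≤m : 1 ℕ.≤ m) (m<t : m ℕ.< t)
    where

    open QuadraticForm form
    open Matrix φ using () renaming (m₁₁ to φ₁₁; m₁₂ to φ₁₂; m₂₁ to φ₂₁; m₂₂ to φ₂₂)

    private
      M : ℕ
      M = q ℕ.^ m

      h⁻¹ n₁ n₂ D : Carrier
      h⁻¹ = inverse h h≢0 .proj₁
      n₁ = h⁻¹ * f
      n₂ = h⁻¹ * g
      D = eval (n₁ ∷ n₂ ∷ 1# ∷ [])

      h*h⁻¹*x : ∀ x → x ≡ h * (h⁻¹ * x)
      h*h⁻¹*x x = sym (trans (sym (*-assoc h h⁻¹ x))
        (trans (cong (_* x) (inverse h h≢0 .proj₂)) (*-identityˡ x)))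

      -- The nucleus lies in the radical of the polar form and has last coordinate 1, so
      -- nondegeneracy keeps it off the conic.
      D≢0 : D ≢ 0#
      D≢0 D≡0 = 1#≢0# (Vec.∷-injectiveˡ (Vec.∷-injectiveʳ (Vec.∷-injectiveʳ
        (nonDegenerate (n₁ ∷ n₂ ∷ 1# ∷ []) D≡0 λ w →
          trans (cong₂ (λ f g → QuadraticForm.polar (record { a = a; b = b; c = c; f = f; g = g; h = h }) (n₁ ∷ n₂ ∷ 1# ∷ []) w)
                  (h*h⁻¹*x f) (h*h⁻¹*x g))
            (nucleus-radical w)))))

    -- The coefficients of a X² + h X Y + b Y² after the substitution φ. Doubled products vanish in
    -- the middle one, which leaves h det φ, a nonzero cross term.
    open BinaryForm
      (a * φ₁₁ * φ₁₁ + h * φ₁₁ * φ₂₁ + b * φ₂₁ * φ₂₁)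
      (h * (φ₁₁ * φ₂₂ - φ₁₂ * φ₂₁))
      (a * φ₁₂ * φ₁₂ + h * φ₁₂ * φ₂₂ + b * φ₂₂ * φ₂₂)

    private
      module T = FrobeniusGraph M (^qᵐ-distrib-+ m) θ≢0 (x*y≢0 h≢0 detφ≢0)
        (∃-nonfixed 1≤m m<t .proj₂)
        (∃-nontrivial-fixed m .proj₂ .proj₁)
        (∃-nontrivial-fixed m .proj₂ .proj₂ .proj₁)
        (∃-nontrivial-fixed m .proj₂ .proj₂ .proj₂)

    -- The terms linear in the displacement cancel because f = h n₁ and g = h n₂; this is what
    -- singles out the nucleus as origin.
    eval-from-nucleus : ∀ x y → eval ((n₁ + (φ₁₁ * x + φ₁₂ * y)) ∷ (n₂ + (φ₂₁ * x + φ₂₂ * y)) ∷ 1# ∷ []) ≡ D + Q x y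
    eval-from-nucleus x y = begin
      eval ((n₁ + X) ∷ (n₂ + Y) ∷ 1# ∷ [])
        ≡⟨ solve₂ 10 (λ a b c f g h n₁ n₂ X Y → :eval a b c f g h (n₁ ⊕ X) (n₂ ⊕ Y) (con₂ true) ≔
             :eval a b c f g h n₁ n₂ (con₂ true) ⊕ (a ⊗ X ⊗ X ⊕ h ⊗ X ⊗ Y ⊕ b ⊗ Y ⊗ Y)
             ⊕ ((f ⊕ h ⊗ n₁) ⊗ Y ⊕ (g ⊕ h ⊗ n₂) ⊗ X)) refl a b c f g h n₁ n₂ X Y ⟩
      D + (a * X * X + h * X * Y + b * Y * Y) + ((f + h * n₁) * Y + (g + h * n₂) * X)
        ≡⟨ cong₂ (λ f′ g′ → D + (a * X * X + h * X * Y + b * Y * Y) + ((f + f′) * Y + (g + g′) * X))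
             (h*h⁻¹*x f) (h*h⁻¹*x g) ⟨
      D + (a * X * X + h * X * Y + b * Y * Y) + ((f + f) * Y + (g + g) * X)
        ≡⟨ solve₂ 5 (λ z f g X Y → z ⊕ ((f ⊕ f) ⊗ Y ⊕ (g ⊕ g) ⊗ X) ≔ z) refl _ f g X Y ⟩
      D + (a * X * X + h * X * Y + b * Y * Y)
        ≡⟨ cong (D +_) (solve₂ 9 (λ a b h p r s w x y →
             a ⊗ (p ⊗ x ⊕ r ⊗ y) ⊗ (p ⊗ x ⊕ r ⊗ y) ⊕ h ⊗ (p ⊗ x ⊕ r ⊗ y) ⊗ (s ⊗ x ⊕ w ⊗ y)
               ⊕ b ⊗ (s ⊗ x ⊕ w ⊗ y) ⊗ (s ⊗ x ⊕ w ⊗ y) ≔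
             (a ⊗ p ⊗ p ⊕ h ⊗ p ⊗ s ⊕ b ⊗ s ⊗ s) ⊗ x ⊗ x ⊕ h ⊗ (p ⊗ w ⊖ r ⊗ s) ⊗ x ⊗ y
               ⊕ (a ⊗ r ⊗ r ⊕ h ⊗ r ⊗ w ⊕ b ⊗ w ⊗ w) ⊗ y ⊗ y)
             refl a b h φ₁₁ φ₁₂ φ₂₁ φ₂₂ x y) ⟩
      D + Q x y
        ∎
      where
      X = φ₁₁ * x + φ₁₂ * y
      Y = φ₂₁ * x + φ₂₂ * y

    graphPoint : Carrier → V → Carrier → V
    graphPoint u v s = v +ᵛ φ · (s ∷ s ^ M * u ∷ [])

    -- Once v is cancelled, the first row of the adjugate of φ recovers det φ · s.
    graphPoint-injective : ∀ {u v s s′} → graphPoint u v s ≡ graphPoint u v s′ → s ≡ s′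
    graphPoint-injective {u} {v₁ ∷ v₂ ∷ []} {s} {s′} eq = *-cancelˡ-≢0 detφ≢0 (begin
      det φ * s
        ≡⟨ recover s (s ^ M * u) ⟩
      φ₂₂ * (v₁ + (φ₁₁ * s + φ₁₂ * (s ^ M * u))) + φ₁₂ * (v₂ + (φ₂₁ * s + φ₂₂ * (s ^ M * u))) + (φ₂₂ * v₁ + φ₁₂ * v₂)
        ≡⟨ cong₂ (λ X Y → φ₂₂ * X + φ₁₂ * Y + (φ₂₂ * v₁ + φ₁₂ * v₂))
             (Vec.∷-injectiveˡ eq) (Vec.∷-injectiveˡ (Vec.∷-injectiveʳ eq)) ⟩
      φ₂₂ * (v₁ + (φ₁₁ * s′ + φ₁₂ * (s′ ^ M * u))) + φ₁₂ * (v₂ + (φ₂₁ * s′ + φ₂₂ * (s′ ^ M * u))) + (φ₂₂ * v₁ + φ₁₂ * v₂)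
        ≡⟨ recover s′ (s′ ^ M * u) ⟨
      det φ * s′
        ∎)
      where
      recover : ∀ x y → det φ * x ≡
        φ₂₂ * (v₁ + (φ₁₁ * x + φ₁₂ * y)) + φ₁₂ * (v₂ + (φ₂₁ * x + φ₂₂ * y)) + (φ₂₂ * v₁ + φ₁₂ * v₂)
      recover x y = solve₂ 8 (λ p r s w x y v₁ v₂ → (p ⊗ w ⊖ r ⊗ s) ⊗ x ≔
        w ⊗ (v₁ ⊕ (p ⊗ x ⊕ r ⊗ y)) ⊕ r ⊗ (v₂ ⊕ (s ⊗ x ⊕ w ⊗ y)) ⊕ (w ⊗ v₁ ⊕ r ⊗ v₂))
        refl φ₁₁ φ₁₂ φ₂₁ φ₂₂ x y v₁ v₂

    OnConic : V → Set
    OnConic (x ∷ y ∷ []) = eval (x ∷ y ∷ 1# ∷ []) ≡ 0#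

    CollinearTriple : Set
    CollinearTriple = ∃ λ u → u ≢ 0# × N u ≡ N θ × ∃ λ v → ∃ λ (s : Fin 3 → Carrier) →
                      Injective _≡_ _≡_ s × ∀ i → OnConic (graphPoint u v (s i))

    module Scaling {s₁ s₂ v₁ v₂ : Carrier}
      (d≢0 : det₂ s₁ (s₁ ^ M * θ) s₂ (s₂ ^ M * θ) ≢ 0#) (Qv≢0 : Q v₁ v₂ ≢ 0#)
      (Qv+₁ : Q (v₁ + s₁) (v₂ + s₁ ^ M * θ) ≡ Q v₁ v₂)
      (Qv+₂ : Q (v₁ + s₂) (v₂ + s₂ ^ M * θ) ≡ Q v₁ v₂)
      where

      n : V
      n = n₁ ∷ n₂ ∷ []

      Qv⁻¹ ω : Carrier
      Qv⁻¹ = inverse (Q v₁ v₂) Qv≢0 .proj₁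
      -- A square root of D / Q(v), to make Q(ωv) = ω² Q(v) equal to D.
      ω = even⇒square 2∣qᵗ (D * Qv⁻¹) .proj₁

      ω²*Qv≡D : ω * ω * Q v₁ v₂ ≡ D
      ω²*Qv≡D = begin
        ω * ω * Q v₁ v₂         ≡⟨ cong (_* Q v₁ v₂) (even⇒square 2∣qᵗ (D * Qv⁻¹) .proj₂) ⟩
        D * Qv⁻¹ * Q v₁ v₂      ≡⟨ solve₂ 3 (λ x y z → x ⊗ y ⊗ z ≔ x ⊗ (z ⊗ y)) refl D Qv⁻¹ (Q v₁ v₂) ⟩
        D * (Q v₁ v₂ * Qv⁻¹)    ≡⟨ cong (D *_) (inverse (Q v₁ v₂) Qv≢0 .proj₂) ⟩
        D * 1#                  ≡⟨ *-identityʳ D ⟩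
        D                       ∎

      ω≢0 : ω ≢ 0#
      ω≢0 ω≡0 = D≢0 (begin
        D                   ≡⟨ ω²*Qv≡D ⟨
        ω * ω * Q v₁ v₂     ≡⟨ cong (λ ω → ω * ω * Q v₁ v₂) ω≡0 ⟩
        0# * 0# * Q v₁ v₂   ≡⟨ solve₂ 1 (λ x → con₂ false ⊗ con₂ false ⊗ x ≔ con₂ false) refl (Q v₁ v₂) ⟩
        0#                  ∎)

      ω⁻ᴹ u : Carrier
      ω⁻ᴹ = inverse (ω ^ M) (x^k≢0 M ω≢0) .proj₁
      -- Dividing by ω^M compensates for (ωs)^M = ω^M s^M, so that multiplication by ω carries the
      -- graph for θ onto the graph for u.
      u = θ * (ω * ω⁻ᴹ)

      ωᴹ*ω⁻ᴹ≡1 : ω ^ M * ω⁻ᴹ ≡ 1#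
      ωᴹ*ω⁻ᴹ≡1 = inverse (ω ^ M) (x^k≢0 M ω≢0) .proj₂

      u≢0 : u ≢ 0#
      u≢0 = x*y≢0 θ≢0 (x*y≢0 ω≢0 (x*y≡1⇒y≢0 ωᴹ*ω⁻ᴹ≡1))

      -- A Frobenius power preserves the norm, so ω / ω^M has norm 1.
      Nu≡Nθ : N u ≡ N θ
      Nu≡Nθ = begin
        N (θ * (ω * ω⁻ᴹ))          ≡⟨ N-distrib-* θ _ ⟩
        N θ * N (ω * ω⁻ᴹ)          ≡⟨ cong (N θ *_) (N-distrib-* ω ω⁻ᴹ) ⟩
        N θ * (N ω * N ω⁻ᴹ)        ≡⟨ cong (λ z → N θ * (z * N ω⁻ᴹ)) (N-^qᵐ m ω≢0) ⟨
        N θ * (N (ω ^ M) * N ω⁻ᴹ)  ≡⟨ cong (N θ *_) (N-distrib-* (ω ^ M) ω⁻ᴹ) ⟨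
        N θ * N (ω ^ M * ω⁻ᴹ)      ≡⟨ cong (λ z → N θ * N z) ωᴹ*ω⁻ᴹ≡1 ⟩
        N θ * N 1#                 ≡⟨ cong (N θ *_) (1^k≡1 normExponent) ⟩
        N θ * 1#                   ≡⟨ *-identityʳ (N θ) ⟩
        N θ                        ∎

      scale-graph : ∀ s → (ω * s) ^ M * u ≡ ω * (s ^ M * θ)
      scale-graph s = begin
        (ω * s) ^ M * u
          ≡⟨ cong (_* u) (^-distrib-* ω s M) ⟩
        ω ^ M * s ^ M * (θ * (ω * ω⁻ᴹ))
          ≡⟨ solve₂ 5 (λ x y z w v → x ⊗ y ⊗ (z ⊗ (w ⊗ v)) ≔ x ⊗ v ⊗ (w ⊗ (y ⊗ z))) refl (ω ^ M) (s ^ M) θ ω ω⁻ᴹ ⟩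
        ω ^ M * ω⁻ᴹ * (ω * (s ^ M * θ))
          ≡⟨ cong (_* (ω * (s ^ M * θ))) ωᴹ*ω⁻ᴹ≡1 ⟩
        1# * (ω * (s ^ M * θ))
          ≡⟨ *-identityˡ _ ⟩
        ω * (s ^ M * θ)
          ∎

      -- Parameter 0 stands for v itself; the triple is v, v + p₁, v + p₂ scaled by ω.
      r s : Fin 3 → Carrier
      r 0F = 0#
      r 1F = s₁
      r 2F = s₂
      s i = ω * r i

      0ᴹ≡0 : 0# ^ M ≡ 0#
      0ᴹ≡0 = T.0-fixed

      s₁≢0 : s₁ ≢ 0#
      s₁≢0 s₁≡0 = d≢0 (begin
        s₁ * (s₂ ^ M * θ) + s₂ * (s₁ ^ M * θ)   ≡⟨ cong (λ s → s * (s₂ ^ M * θ) + s₂ * (s ^ M * θ)) s₁≡0 ⟩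
        0# * (s₂ ^ M * θ) + s₂ * (0# ^ M * θ)   ≡⟨ cong (λ z → 0# * (s₂ ^ M * θ) + s₂ * (z * θ)) 0ᴹ≡0 ⟩
        0# * (s₂ ^ M * θ) + s₂ * (0# * θ)       ≡⟨ solve₂ 3 (λ x y z → con₂ false ⊗ x ⊕ y ⊗ (con₂ false ⊗ z) ≔ con₂ false) refl _ s₂ θ ⟩
        0#                                      ∎)

      s₂≢0 : s₂ ≢ 0#
      s₂≢0 s₂≡0 = d≢0 (begin
        s₁ * (s₂ ^ M * θ) + s₂ * (s₁ ^ M * θ)   ≡⟨ cong (λ s → s₁ * (s ^ M * θ) + s * (s₁ ^ M * θ)) s₂≡0 ⟩
        s₁ * (0# ^ M * θ) + 0# * (s₁ ^ M * θ)   ≡⟨ cong (λ z → s₁ * (z * θ) + 0# * (s₁ ^ M * θ)) 0ᴹ≡0 ⟩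
        s₁ * (0# * θ) + 0# * (s₁ ^ M * θ)       ≡⟨ solve₂ 3 (λ x y z → y ⊗ (con₂ false ⊗ z) ⊕ con₂ false ⊗ x ≔ con₂ false) refl _ s₁ θ ⟩
        0#                                      ∎)

      s₁≢s₂ : s₁ ≢ s₂
      s₁≢s₂ s₁≡s₂ = d≢0 (trans
        (cong (λ s → s₁ * (s ^ M * θ) + s * (s₁ ^ M * θ)) (sym s₁≡s₂)) (x+x≡0 _))

      r-injective : Injective _≡_ _≡_ r
      r-injective {0F} {0F} _  = refl
      r-injective {0F} {1F} eq = contradiction (sym eq) s₁≢0
      r-injective {0F} {2F} eq = contradiction (sym eq) s₂≢0
      r-injective {1F} {0F} eq = contradiction eq s₁≢0
      r-injective {1F} {1F} _  = refl
      r-injective {1F} {2F} eq = contradiction eq s₁≢s₂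
      r-injective {2F} {0F} eq = contradiction eq s₂≢0
      r-injective {2F} {1F} eq = contradiction (sym eq) s₁≢s₂
      r-injective {2F} {2F} _  = refl

      s-injective : Injective _≡_ _≡_ s
      s-injective = r-injective ∘ *-cancelˡ-≢0 ω≢0

      Q-translate : ∀ i → Q (v₁ + r i) (v₂ + r i ^ M * θ) ≡ Q v₁ v₂
      Q-translate 0F = cong₂ Q (+-identityʳ v₁) (begin
        v₂ + 0# ^ M * θ   ≡⟨ cong (λ z → v₂ + z * θ) 0ᴹ≡0 ⟩
        v₂ + 0# * θ       ≡⟨ cong (v₂ +_) (zeroˡ θ) ⟩
        v₂ + 0#           ≡⟨ +-identityʳ v₂ ⟩
        v₂                ∎)
      Q-translate 1F = Qv+₁
      Q-translate 2F = Qv+₂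

      -- Each point is the nucleus displaced by the φ-image of ω(v + pᵢ), with p₀ = 0. The form
      -- there is D + ω² Q(v + pᵢ) = D + ω² Q(v) = D + D = 0.
      on : ∀ i → OnConic (graphPoint u (n +ᵛ φ · (ω * v₁ ∷ ω * v₂ ∷ [])) (s i))
      on i = begin
        eval (n₁ + (φ₁₁ * (ω * v₁) + φ₁₂ * (ω * v₂)) + (φ₁₁ * (ω * r i) + φ₁₂ * ((ω * r i) ^ M * u))
          ∷ n₂ + (φ₂₁ * (ω * v₁) + φ₂₂ * (ω * v₂)) + (φ₂₁ * (ω * r i) + φ₂₂ * ((ω * r i) ^ M * u)) ∷ 1# ∷ [])
          ≡⟨ cong₂ (λ x y → eval (x ∷ y ∷ 1# ∷ [])) (regroup n₁ φ₁₁ φ₁₂) (regroup n₂ φ₂₁ φ₂₂) ⟩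
        eval (n₁ + (φ₁₁ * (ω * x) + φ₁₂ * (ω * y)) ∷ n₂ + (φ₂₁ * (ω * x) + φ₂₂ * (ω * y)) ∷ 1# ∷ [])
          ≡⟨ eval-from-nucleus (ω * x) (ω * y) ⟩
        D + Q (ω * x) (ω * y)
          ≡⟨ cong (D +_) (Q-scale ω x y) ⟩
        D + ω * ω * Q x y
          ≡⟨ cong (λ z → D + ω * ω * z) (Q-translate i) ⟩
        D + ω * ω * Q v₁ v₂
          ≡⟨ cong (D +_) ω²*Qv≡D ⟩
        D + D
          ≡⟨ x+x≡0 D ⟩
        0#
          ∎
        where
        x = v₁ + r i
        y = v₂ + r i ^ M * θ
        regroup : ∀ k p p′ → k + (p * (ω * v₁) + p′ * (ω * v₂)) + (p * (ω * r i) + p′ * ((ω * r i) ^ M * u)) ≡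
                  k + (p * (ω * x) + p′ * (ω * y))
        regroup k p p′ = trans
          (cong (λ z → k + (p * (ω * v₁) + p′ * (ω * v₂)) + (p * (ω * r i) + p′ * z)) (scale-graph (r i)))
          (solve₂ 8 (λ k p p′ ω v₁ v₂ r z → k ⊕ (p ⊗ (ω ⊗ v₁) ⊕ p′ ⊗ (ω ⊗ v₂)) ⊕ (p ⊗ (ω ⊗ r) ⊕ p′ ⊗ (ω ⊗ z)) ≔
             k ⊕ (p ⊗ (ω ⊗ (v₁ ⊕ r)) ⊕ p′ ⊗ (ω ⊗ (v₂ ⊕ z)))) refl k p p′ ω v₁ v₂ (r i) (r i ^ M * θ))

      scaledTriple : CollinearTriple
      scaledTriple = u , u≢0 , Nu≡Nθ , n +ᵛ φ · (ω * v₁ ∷ ω * v₂ ∷ []) , s , s-injective , on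

    collinearTriple : CollinearTriple
    collinearTriple =
      let s₁ , s₂ , d≢0 , Q₁≢0 , Q₂≢0 , Q₁₂≢0 = T.independentNonZeros
          v₁ , v₂ , Qv≢0 , Qv+₁ , Qv+₂ = equidistant (x*y≢0 h≢0 detφ≢0) d≢0 Q₁≢0 Q₂≢0 Q₁₂≢0
      in Scaling.scaledTriple d≢0 Qv≢0 Qv+₁ Qv+₂

  -- 𝒟 is nonempty, and each of its points exhibits δ as a norm.
  δ-isNorm : ∀ {𝒟} → IsAndréSet 𝒟 → (ρ : Presentation 𝒟) → ∃ λ θ → θ ≢ 0# × N θ ≡ Presentation.δ ρ
  δ-isNorm (_ , _ , _ , H , H-subgroup , _ , _ , P@((x ∷ y ∷ []) , _) , _ , _ , orbit) ρ
    with _ , (θ , θ≢0 , Nθ≡δ , _) , _ ← Equivalence.to (Presentation.image ρ P)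
           -- The base point P lies in its own orbit through the identity of H, with scalar 1.
           (Equivalence.from (orbit P) (identity , IsSubgroup.ε-closed H-subgroup , 1# , 1#≢0# ,
             cong₂ _∷_ (sym (trans (*-identityˡ _) (trans (cong₂ _+_ (*-identityˡ x) (zeroˡ y)) (+-identityʳ x))))
               (cong (_∷ []) (sym (trans (*-identityˡ _) (trans (cong₂ _+_ (zeroˡ x) (*-identityˡ y)) (+-identityˡ y)))))))
    = θ , θ≢0 , Nθ≡δ

  -- The triple contradicts the arc property

  conic-notArc : (𝒞 : Conic) (𝒟 : Pred (PG 1) 0ℓ) → IsAndréSet 𝒟 → (ρ : Presentation 𝒟) →
    Exterior ℓ∞ 𝒞 ⊎ Secant ℓ∞ 𝒞 → (m : ℕ) → 1 ℕ.≤ m → m ℕ.< t →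
    ¬ IncidenceStructure.IsArc (AndréPlane 𝒟 ρ m) (AndréImage 𝒟 ρ m 𝒞)
  conic-notArc 𝒞 𝒟 andré ρ ext⊎sec m 1≤m m<t arc =
    let _ , θ≢0 , Nθ≡δ = δ-isNorm andré ρ in norm⇒⊥ θ≢0 Nθ≡δ
    where
    open IncidenceStructure (AndréPlane 𝒟 ρ m)

    norm⇒⊥ : ∀ {θ} → θ ≢ 0# → N θ ≡ Presentation.δ ρ → ⊥
    norm⇒⊥ {θ} θ≢0 Nθ≡δ = triple⇒⊥ collinearTriple
      where
      open BlockConstruction (Conic.form 𝒞) (Conic.nonDegenerate 𝒞) (¬tangent⇒h≢0 𝒞 ext⊎sec)
        (Presentation.φ ρ) (Presentation.φ-invertible ρ) θ≢0 1≤m m<t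

      triple⇒⊥ : CollinearTriple → ⊥
      triple⇒⊥ (u , u≢0 , Nu≡Nθ , v , s , s-injective , on) =
        arc (point 0F) (point 1F) (point 2F) (point∈ 0F) (point∈ 1F) (point∈ 2F)
            (distinct 0F 1F λ ()) (distinct 0F 2F λ ()) (distinct 1F 2F λ ())
            ℓ (incident 0F , incident 1F , incident 2F)
        where
        point : Fin 3 → Point
        point i = inj₁ (graphPoint u v (s i))

        ℓ : Line
        ℓ = inj₁ (block u u≢0 (trans Nu≡Nθ Nθ≡δ) v)

        -- Both predicates are defined by matching on the vector, so they agree only once its two
        -- coordinates are exposed.
        onConic⇒∈ : ∀ w → OnConic w → w ∈ Conic.affinePoints 𝒞
        onConic⇒∈ (_ ∷ _ ∷ []) w∈𝒞 = w∈𝒞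

        point∈ : ∀ i → point i ∈ AndréImage 𝒟 ρ m 𝒞
        point∈ i = onConic⇒∈ (graphPoint u v (s i)) (on i)

        distinct : ∀ i j → i ≢ j → ¬ point i ≈ point j
        distinct i j i≢j (Pointwise.inj₁ eq) = i≢j (s-injective (graphPoint-injective {u} {v} eq))

        incident : ∀ i → point i I ℓ
        incident i = _ , (_ , (s i , refl) , refl) , refl

open import Data.Nat.Base using (_≤_; _<_; _^_)

theorem6 : (q t : ℕ) → IsPrimePower q → 2 ∣ q → Prime t → 3 ≤ t → t ≤ q →
    (K : FiniteField (q ^ t)) → let open Geometry q t K in
    (𝒞 : Conic) (𝒟 : Pred (PG 1) 0ℓ) → IsAndréSet 𝒟 → (ρ : Presentation 𝒟) →
    Exterior ℓ∞ 𝒞 ⊎ Secant ℓ∞ 𝒞 →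
    (m : ℕ) → 1 ≤ m → m < t →
    ¬ IncidenceStructure.IsArc (AndréPlane 𝒟 ρ m) (AndréImage 𝒟 ρ m 𝒞)
theorem6 q t q-primePower 2∣q _ 3≤t t≤q K =
  -- From 3 ≤ t ≤ q comes q ≥ 3, the bound behind a fixed scalar other than 0 and 1.
  EvenGeometry.conic-notArc q t q-primePower 2∣q 3≤t (ℕ.≤-trans 3≤t t≤q) K
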